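{- Let $G$ be a finite group which is a direct product of elementary abelian groups, let $\mathcal{A}$ be an $S$-ring over $G$, and let $S=U/L$ be an $\mathcal{A}$-section of $G$. Suppose that $\mathcal{A}$ is the nontrivial $S$-wreath product (i.e. $L\neq\{e\}$ and $U\neq G$), and that the $S$-rings $\mathcal{A}_U$ and $\mathcal{A}_{G/L}$ are $CI$-$S$-rings. If $$\mathrm{Aut}_{S}(\mathcal{A}_{S})=\mathrm{Aut}_U(\mathcal{A}_U)^{S}\,\mathrm{Aut}_{G/L}(\mathcal{A}_{G/L})^{S},$$ then $\mathcal{A}$ is a $CI$-$S$-ring. In particular, $\mathcal{A}$ is a $CI$-$S$-ring if $\mathrm{Aut}_{S}(\mathcal{A}_{S})=\mathrm{Aut}_U(\mathcal{A}_U)^{S}$ or $\mathrm{Aut}_{S}(\mathcal{A}_{S})=\mathrm{Aut}_{G/L}(\mathcal{A}_{G/L})^{S}$.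
   Context: For a finite group $G$ with identity $e$ and $X\subseteq G$, write $\underline{X}=\sum_{x\in X}x\in\mathbb{Z}G$ and $X^{ -1}=\{x^{ -1}:x\in X\}$. An $S$-ring over $G$ is a subring $\mathcal{A}\subseteq\mathbb{Z}G$ for which there is a partition $\mathcal{S}(\mathcal{A})$ of $G$ (the basic sets) with $\{e\}\in\mathcal{S}(\mathcal{A})$, $X^{ -1}\in\mathcal{S}(\mathcal{A})$ whenever $X\in\mathcal{S}(\mathcal{A})$, and $\mathcal{A}=\mathrm{Span}_{\mathbb{Z}}\{\underline{X}:X\in\mathcal{S}(\mathcal{A})\}$. A subgroup $H\le G$ is an $\mathcal{A}$-subgroup if $\underline{H}\in\mathcal{A}$. If $L\trianglelefteq U\le G$ are $\mathcal{A}$-subgroups, $U/L$ is an $\mathcal{A}$-section, and the quotient $S$-ring $\mathcal{A}_{U/L}$ over $U/L$ is the span of the images $\pi(X)$ (as elements of $\mathbb{Z}(U/L)$) of basic sets $X\subseteq U$ under the canonical epimorphism $\pi:U\to U/L$; its basic sets are the sets $\pi(X)$. We write $\mathcal{A}_U=\mathcal{A}_{U/\{e\}}$ and $\mathcal{A}_{G/L}=\mathcal{A}_{G/L}$ for an $\mathcal{A}$-subgroup $L\trianglelefteq G$. The radical of $X\subseteq G$ is $\mathrm{rad}(X)=\{g\in G: gX=Xg=X\}$. For an $\mathcal{A}$-section $S=U/L$, $\mathcal{A}$ is the $S$-wreath product if $L\trianglelefteq G$ and $L\le\mathrm{rad}(X)$ for every basic set $X$ not contained in $U$; it is nontrivial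 if $L\ne\{e\}$ and $U\ne G$. For $X\in\mathcal{S}(\mathcal{A})$ let $R(X)=\{(g,xg):g\in G,x\in X\}$. An isomorphism from $\mathcal{A}$ to an $S$-ring $\mathcal{A}'$ over $G'$ is a bijection $f:G\to G'$ with $\{R(X)^f:X\in\mathcal{S}(\mathcal{A})\}=\{R(X'):X'\in\mathcal{S}(\mathcal{A}')\}$, where $R^f=\{(g^f,h^f):(g,h)\in R\}$. $\mathrm{Aut}(\mathcal{A})$ is the group of bijections $f$ of $G$ with $R(X)^f=R(X)$ for all $X\in\mathcal{S}(\mathcal{A})$; $\mathrm{Aut}_G(\mathcal{A})=\mathrm{Aut}(\mathcal{A})\cap\mathrm{Aut}(G)$ (group automorphisms $f$ of $G$ with $X^f=X$ for all basic sets $X$). $\mathrm{Iso}(\mathcal{A})$ is the set of permutations of $G$ that are isomorphisms from $\mathcal{A}$ onto some $S$-ring over $G$. $\mathcal{A}$ is a $CI$-$S$-ring if $\mathrm{Iso}(\mathcal{A})=\mathrm{Aut}(\mathcal{A})\mathrm{Aut}(G)$. For a set $\Delta$ of permutations of a group $H$ and a section $S=U/L$ of $H$, $\Delta^S=\{f^S: f\in\Delta,\ S^f=S\}$, where $S^f=S$ means $f$ maps $U$ onto itself and permutes the $L$-cosets in $U$, and $f^S$ is the induced bijection of $S$. Here $\mathrm{Aut}_U(\mathcal{A}_U)^S$ and $\mathrm{Aut}_{G/L}(\mathcal{A}_{G/L})^S$ are taken with $S$ viewed as the section $U/L$ of $U$ and as the subgroup $U/L$ (section $(U/L)/\{L\}$)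 of $G/L$, respectively. -}

module Defs where

open import Level using (0ℓ)
open import Algebra.Bundles using (Group)
open import Data.Bool using (Bool; true; false; _∧_; T; not)
open import Data.Nat using (ℕ; zero; suc)
open import Data.Nat.Primality using (Prime)
open import Data.Fin using (Fin) renaming (zero to fzero; suc to fsuc)
open import Data.List using (List; filterᵇ; deduplicateᵇ; length)
open import Data.Bool.ListAction using (any)
open import Data.List.Relation.Unary.Any using (Any)
open import Data.Product using (Σ; ∃; ∃-syntax; _×_; _,_)
open import Function using (_∘_)
open import Function.Bundles using (_⇔_)
open import Relation.Nullary using (¬_; does)
open import Relation.Binary.Definitions using (Decidable)
open import Relation.Binary.PropositionalEquality using (_≡_)

record FiniteGroup : Set₁ where
  field
    group    : Group 0ℓ 0ℓ
  open Group group public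
  field
    _≟_      : Decidable _≈_
    elems    : List Carrier
    complete : ∀ x → Any (x ≈_) elems

module _ (G : FiniteGroup) where
  open FiniteGroup G

  Subset : Set
  Subset = Carrier → Bool

  full : Subset
  full _ = true

  trivial : Subset
  trivial x = does (x ≟ ε)

  _⊆_ : Subset → Subset → Set
  A ⊆ B = ∀ x → T (A x) → T (B x)

  record IsSubgroup (H : Subset) : Set where
    field
      resp  : ∀ {x y} → x ≈ y → H x ≡ H y
      ε∈    : T (H ε)
      ∙∈    : ∀ x y → T (H x) → T (H y) → T (H (x ∙ y))
      ⁻¹∈   : ∀ x → T (H x) → T (H (x ⁻¹))

  IsNormalIn : Subset → Subset → Set
  IsNormalIn L U = IsSubgroup L × IsSubgroup U × (L ⊆ U)
    × (∀ u l → T (U u) → T (L l) → T (L (u ∙ l ∙ u ⁻¹)))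

  IsAbelian : Set
  IsAbelian = ∀ x y → (x ∙ y) ≈ (y ∙ x)

  pow : Carrier → ℕ → Carrier
  pow x zero    = ε
  pow x (suc n) = x ∙ pow x n

  -- H is an elementary abelian subgroup (G is assumed abelian separately)
  IsElemAbelian : Subset → Set
  IsElemAbelian H = ∃[ p ] (Prime p × (∀ x → T (H x) → pow x p ≈ ε))

  prodF : ∀ {k} → (Fin k → Carrier) → Carrier
  prodF {zero}  h = ε
  prodF {suc k} h = h fzero ∙ prodF (h ∘ fsuc)

  IsDirProdElemAb : Set
  IsDirProdElemAb = IsAbelian × ∃[ k ] Σ (Fin k → Subset) λ E →
      (∀ i → IsSubgroup (E i) × IsElemAbelian (E i))
    × (∀ g → ∃[ h ] ((∀ i → T (E i (h i))) × g ≈ prodF h))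
    × (∀ h h' → (∀ i → T (E i (h i))) → (∀ i → T (E i (h' i)))
         → prodF h ≈ prodF h' → ∀ i → h i ≈ h' i)

  -- Everything below is relative to a section U/L of G: its elements are
  -- the elements of U, two of them being equal iff they lie in the same
  -- L-coset.  (G = G/{e}, U = U/{e}, G/L, U/L.)

  module _ (U L : Subset) where

    In : Carrier → Set
    In x = T (U x)

    _≡L_ : Carrier → Carrier → Set
    x ≡L y = T (L (x ⁻¹ ∙ y))

    count : (Carrier → Bool) → ℕ
    count P = length (deduplicateᵇ (λ x y → L (x ⁻¹ ∙ y))
                                   (filterᵇ (λ x → U x ∧ P x) elems))

    record IsPerm (f : Carrier → Carrier) : Set where
      field
        inv     : Carrier → Carrier
        f-In    : ∀ x → In x → In (f x)
        inv-In  : ∀ x → In x → In (inv x)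
        f-cong  : ∀ x y → In x → In y → x ≡L y → f x ≡L f y
        inv-cong : ∀ x y → In x → In y → x ≡L y → inv x ≡L inv y
        left    : ∀ x → In x → inv (f x) ≡L x
        right   : ∀ x → In x → f (inv x) ≡L x

    IsAut : (Carrier → Carrier) → Set
    IsAut f = IsPerm f × (∀ x y → In x → In y → f (x ∙ y) ≡L (f x ∙ f y))

    -- An S-ring over the section, given by the partition into basic sets,
    -- encoded as the (decidable) relation "lie in the same basic set".
    record IsSRing (_~_ : Carrier → Carrier → Bool) : Set where
      field
        cong     : ∀ x x' y y' → In x → In x' → In y → In y'
                   → x ≡L x' → y ≡L y' → (x ~ y) ≡ (x' ~ y')
        refl     : ∀ x → In x → T (x ~ x)
        sym      : ∀ x y → In x → In y → T (x ~ y) → T (y ~ x)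
        trans    : ∀ x y z → In x → In y → In z
                   → T (x ~ y) → T (y ~ z) → T (x ~ z)
        identity : ∀ x → In x → T (x ~ ε) → x ≡L ε
        inverse  : ∀ x y → In x → In y → T (x ~ y) → T ((x ⁻¹) ~ (y ⁻¹))
        -- the span is a subring: the coefficient of z in X̲·Y̲
        -- (X ∋ a, Y ∋ b) is constant on basic sets
        closed   : ∀ a b z z' → In a → In b → In z → In z' → T (z ~ z')
                   → count (λ x → (x ~ a) ∧ ((x ⁻¹ ∙ z) ~ b))
                     ≡ count (λ x → (x ~ a) ∧ ((x ⁻¹ ∙ z') ~ b))

    -- f is an isomorphism from the S-ring (~) onto the S-ring (~'):
    -- {R(X)^f} = {R(X')}, where (g,h) ∈ R(X) iff h g⁻¹ ∈ X.
    IsIsoTo : (Carrier → Carrier) → (_~_ _~'_ : Carrier → Carrier → Bool) → Set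
    IsIsoTo f _~_ _~'_ =
        (∀ a → In a → ∃[ b ] (In b × (∀ g h → In g → In h →
            (T ((h ∙ g ⁻¹) ~ a) ⇔ T ((f h ∙ f g ⁻¹) ~' b)))))
      × (∀ b → In b → ∃[ a ] (In a × (∀ g h → In g → In h →
            (T ((h ∙ g ⁻¹) ~ a) ⇔ T ((f h ∙ f g ⁻¹) ~' b)))))

    IsoA : (Carrier → Carrier → Bool) → (Carrier → Carrier) → Set
    IsoA _~_ f = IsPerm f × ∃[ _~'_ ] (IsSRing _~'_ × IsIsoTo f _~_ _~'_)

    AutA : (Carrier → Carrier → Bool) → (Carrier → Carrier) → Set
    AutA _~_ f = IsPerm f × (∀ a → In a → ∀ g h → In g → In h →
            (T ((h ∙ g ⁻¹) ~ a) ⇔ T ((f h ∙ f g ⁻¹) ~ a)))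

    AutGA : (Carrier → Carrier → Bool) → (Carrier → Carrier) → Set
    AutGA _~_ f = IsAut f × (∀ a x → In a → In x → (T (x ~ a) ⇔ T (f x ~ a)))

    -- CI-S-ring:  Iso(A) = Aut(A) Aut(G)   (x^{ab} = (x^a)^b)
    IsCI : (Carrier → Carrier → Bool) → Set
    IsCI _~_ =
        (∀ f → IsoA _~_ f → ∃[ a ] ∃[ b ] (AutA _~_ a × IsAut b
                × (∀ x → In x → f x ≡L b (a x))))
      × (∀ a b → AutA _~_ a → IsAut b → IsoA _~_ (b ∘ a))

  -- S-rings over G itself are S-rings over the section G/{e}.

  IsASubgroup : (Carrier → Carrier → Bool) → Subset → Set
  IsASubgroup _~_ H = IsSubgroup H × (∀ x y → T (x ~ y) → H x ≡ H y)

  -- the quotient S-ring A_{U/L}: π(x), π(y) lie in the same basic set iff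
  -- both lie in π(X) for one basic set X, i.e. there are a ∈ xL, b ∈ yL
  -- in the same basic set of A.
  quot : Subset → (Carrier → Carrier → Bool) → Carrier → Carrier → Bool
  quot L _~_ x y =
    any (λ a → any (λ b → L (x ⁻¹ ∙ a) ∧ (L (y ⁻¹ ∙ b) ∧ (a ~ b))) elems) elems

  InRad : (Carrier → Carrier → Bool) → Carrier → Carrier → Set
  InRad _~_ a g = ∀ x → (T (x ~ a) ⇔ T ((g ∙ x) ~ a))
                      × (T (x ~ a) ⇔ T ((x ∙ g) ~ a))

  IsWreath : (Carrier → Carrier → Bool) → Subset → Subset → Set
  IsWreath _~_ U L = IsNormalIn L full
    × (∀ a → ¬ (∀ x → T (x ~ a) → T (U x)) → ∀ l → T (L l) → InRad _~_ a l)

  -- f ∈ Aut_U(A_U) with S^f = S (f permutes the L-cosets of U); its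
  -- induced map f^S on S = U/L is f read modulo L.
  InAutUS : (Carrier → Carrier → Bool) → Subset → Subset → (Carrier → Carrier) → Set
  InAutUS _~_ U L f = AutGA U trivial (quot trivial _~_) f
    × (∀ x y → T (U x) → T (U y) → (_≡L_ U L x y ⇔ _≡L_ U L (f x) (f y)))

  InAutGLS : (Carrier → Carrier → Bool) → Subset → Subset → (Carrier → Carrier) → Set
  InAutGLS _~_ U L g = AutGA full L (quot L _~_) g
    × (∀ x → T (U x) ⇔ T (U (g x)))

  ProdCond : (Carrier → Carrier → Bool) → Subset → Subset → Set
  ProdCond _~_ U L =
      (∀ σ → AutGA U L (quot L _~_) σ → ∃[ f ] ∃[ g ]
         (InAutUS _~_ U L f × InAutGLS _~_ U L g
           × (∀ x → T (U x) → _≡L_ U L (σ x) (g (f x)))))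
    × (∀ f g → InAutUS _~_ U L f → InAutGLS _~_ U L g
         → ∃[ σ ] (AutGA U L (quot L _~_) σ
           × (∀ x → T (U x) → _≡L_ U L (σ x) (g (f x)))))

  UCond : (Carrier → Carrier → Bool) → Subset → Subset → Set
  UCond _~_ U L =
      (∀ σ → AutGA U L (quot L _~_) σ → ∃[ f ]
         (InAutUS _~_ U L f × (∀ x → T (U x) → _≡L_ U L (σ x) (f x))))
    × (∀ f → InAutUS _~_ U L f → ∃[ σ ] (AutGA U L (quot L _~_) σ
           × (∀ x → T (U x) → _≡L_ U L (σ x) (f x))))

  GLCond : (Carrier → Carrier → Bool) → Subset → Subset → Set
  GLCond _~_ U L =
      (∀ σ → AutGA U L (quot L _~_) σ → ∃[ g ]
         (InAutGLS _~_ U L g × (∀ x → T (U x) → _≡L_ U L (σ x) (g x))))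
    × (∀ g → InAutGLS _~_ U L g → ∃[ σ ] (AutGA U L (quot L _~_) σ
           × (∀ x → T (U x) → _≡L_ U L (σ x) (g x))))

{-# OPTIONS --safe #-}

-- Let f be an isomorphism from A onto an S-ring over G; after a translation it fixes e, and then it maps
-- the A-subgroups U and L onto subgroups of the same orders.  All of G has squarefree exponent, so an
-- automorphism of G moves these images back, and we may assume that f preserves U and L.  Since A_U and
-- A_{G/L} are CI, there are automorphisms φ₁ of U and φ₂ of G/L that act on the basic sets as f does.
-- Then φ₂⁻¹ φ₁ lies in Aut_S(A_S), and the factorization hypothesis allows us to change φ₁ and φ₂ inside
-- their cosets so that they agree on U/L.  As U has a complement in G, they glue to an automorphism ψ of G,
-- and ψ⁻¹ f fixes every basic set: inside U by the choice of φ₁, outside U because there the basic sets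
-- are unions of L-cosets.

module Submission where

open import Defs
open import Algebra.Bundles using (AbelianGroup)
open import Data.Bool using (Bool; true; false; T; _∧_)
open import Data.Bool.Properties using (T?; T-∧)
open import Data.Empty using (⊥-elim)
open import Data.Fin using (Fin; toℕ; fromℕ<; combine; remQuot) renaming (zero to fzero; suc to fsuc)
import Data.Fin.Properties as Fin
open import Data.List using (List; []; _∷_; tabulate; filterᵇ; deduplicateᵇ; lookup)
open import Data.List.Membership.Propositional using (_∈_)
open import Data.List.Membership.Propositional.Properties using (∈-tabulate⁺; ∈-lookup; ∈-filter⁻; ∈-deduplicate⁻)
import Data.List.Membership.Setoid as Mem
import Data.List.Membership.Setoid.Properties as Memₚ
open import Data.List.Relation.Unary.All as All using (All; []; _∷_)
open import Data.List.Relation.Unary.All.Properties using (tabulate⁺)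
open import Data.List.Relation.Unary.AllPairs using (AllPairs; []; _∷_)
open import Data.List.Relation.Unary.Any as Any using (Any; here; there)
open import Data.List.Relation.Unary.Any.Properties using (any⁺; any⁻)
open import Data.List.Relation.Unary.Unique.DecSetoid.Properties using (deduplicate-!)
open import Data.Nat as ℕ using (ℕ; zero; suc; NonZero; _≤_; _<_)
open import Data.Nat.Coprimality using (Coprime; coprime-Bézout)
open import Data.Nat.DivMod using (_%_; _/_; m≡m%n+[m/n]*n; m%n<n)
open import Data.Nat.Divisibility using (_∣_; divides; _∣?_; ∣⇒≤; m∣m*n; n∣m*n; ∣n⇒∣m*n; ∣m⇒∣m*n; ∣1⇒≡1)
open import Data.Nat.GCD using (module Bézout)
open import Data.Nat.ListAction using (product)
open import Data.Nat.Primality using (Prime; prime⇒nonZero; prime⇒irreducible; euclidsLemma; ¬prime[1])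
import Data.Nat.Properties as ℕₚ
open import Data.Nat.Tactic.RingSolver using (solve-∀)
open import Data.Product using (Σ; ∃; ∃-syntax; _×_; _,_; proj₁; proj₂)
open import Data.Sum using (_⊎_; inj₁; inj₂)
open import Data.Unit using (tt)
open import Function using (_∘_; id)
open import Function.Bundles using (_⇔_; mk⇔; Equivalence)
open import Level using (0ℓ)
open import Relation.Binary.Bundles using (DecSetoid)
open import Relation.Binary.PropositionalEquality as ≡ using (_≡_)
open import Relation.Nullary using (¬_; Dec; yes; no; contradiction)
open import Relation.Nullary.Decidable using (isYes)

-- The group theory (orders, elements of prime order, extension of isomorphisms, gluing) comes from
-- a single induction, `Climb`, which enlarges a subgroup by one element of prime order at a time.
-- It works because for each prime p there is N ≡ 1 modulo p such that every N · g is killed by p,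
-- while N · g and g differ by a multiple of p · g. Thus gluing can extend the map from U generator
-- by generator and never names a complement. On the S-ring side there are two obstacles. A CI
-- hypothesis applies only to an isomorphism onto an S-ring, so the restriction of f to U and its
-- reduction modulo L need target S-rings. The condition that f⁻¹ (f h // f g) and h // g lie in one
-- basic set passes to both, and it makes the image partition an S-ring. Moreover, it is not evident
-- that the quotient relation `quot` is even transitive; the CI hypotheses themselves supply this.

T-ext : ∀ {a b} → (T a → T b) → (T b → T a) → a ≡ b
T-ext {false} {false} _ _ = ≡.refl
T-ext {false} {true}  _ g = ⊥-elim (g tt)
T-ext {true}  {false} f _ = ⊥-elim (f tt)
T-ext {true}  {true}  _ _ = ≡.refl

-- Arithmetic modulo a prime

prime-coprime : ∀ {p k} → Prime p → ¬ (p ∣ k) → Coprime k p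
prime-coprime pr p∤k {d} (d∣k , d∣p) with prime⇒irreducible pr d∣p
... | inj₁ d≡1 = d≡1
... | inj₂ ≡.refl = contradiction d∣k p∤k

prime∣prime⇒≡ : ∀ {p q} → Prime p → Prime q → p ∣ q → p ≡ q
prime∣prime⇒≡ pp pq p∣q with prime⇒irreducible pq p∣q
... | inj₁ ≡.refl = contradiction pp ¬prime[1]
... | inj₂ p≡q = p≡q

inverse-mod-prime : ∀ {p q} → Prime p → Prime q → ¬ (p ≡ q) → ∃[ s ] ∃[ d ] q ℕ.* s ≡ 1 ℕ.+ d ℕ.* p
inverse-mod-prime {p} {q} pp pq p≢q
  with coprime-Bézout (prime-coprime pp (p≢q ∘ prime∣prime⇒≡ pp pq))
... | Bézout.+- x y eq = x , y , ≡.trans (ℕₚ.*-comm q x) (≡.sym eq)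
... | Bézout.-+ x y eq with x ℕ.* q in xq
...   | zero  = contradiction (≡.subst Prime (∣1⇒≡1 (divides y eq)) pp) ¬prime[1]
-- Here x q is -1 modulo p, so its square is 1: with x q = m + 1 the square is 1 + m (m + 2), and m
-- + 2 = y p.
...   | suc m = x ℕ.* (q ℕ.* x) , m ℕ.* y , (begin
    q ℕ.* (x ℕ.* (q ℕ.* x))     ≡⟨ regroup q x ⟩
    (x ℕ.* q) ℕ.* (x ℕ.* q)     ≡⟨ ≡.cong (λ t → t ℕ.* t) xq ⟩
    suc m ℕ.* suc m             ≡⟨ square m ⟩
    1 ℕ.+ m ℕ.* (1 ℕ.+ suc m)   ≡⟨ ≡.cong (λ t → 1 ℕ.+ m ℕ.* t) eq ⟩
    1 ℕ.+ m ℕ.* (y ℕ.* p)       ≡⟨ ≡.cong (1 ℕ.+_) (ℕₚ.*-assoc m y p) ⟨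
    1 ℕ.+ m ℕ.* y ℕ.* p         ∎)
  where
  open ≡.≡-Reasoning
  regroup : ∀ q x → q ℕ.* (x ℕ.* (q ℕ.* x)) ≡ (x ℕ.* q) ℕ.* (x ℕ.* q)
  regroup = solve-∀
  square : ∀ m → suc m ℕ.* suc m ≡ 1 ℕ.+ m ℕ.* (1 ℕ.+ suc m)
  square = solve-∀

-- N is a product of factors q s ≡ 1 modulo p, one for each entry q different from p. Multiplication
-- by N therefore fixes elements of order p and kills those whose order is another prime of the
-- list.
p-part-exponent : ∀ {p} → Prime p → ∀ qs → All Prime qs →
  ∃[ N ] ∃[ c ] (N ≡ 1 ℕ.+ c ℕ.* p) × All (_∣ p ℕ.* N) qs
p-part-exponent pp [] [] = 1 , 0 , ≡.refl , []
p-part-exponent {p} pp (q ∷ qs) (pq ∷ pqs) with p-part-exponent pp qs pqs | p ℕₚ.≟ q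
... | N , c , N≡ , qs∣ | yes ≡.refl = N , c , N≡ , m∣m*n N ∷ qs∣
... | N , c , N≡ , qs∣ | no p≢q with inverse-mod-prime pp pq p≢q
...   | s , d , qs≡ = N ℕ.* (q ℕ.* s) , c ℕ.+ d ℕ.+ c ℕ.* p ℕ.* d
      , ≡.trans (≡.cong₂ ℕ._*_ N≡ qs≡) (expand c d p)
      , ∣n⇒∣m*n p (∣n⇒∣m*n N (m∣m*n s))
        ∷ All.map (λ {r} r∣ → ≡.subst (r ∣_) (ℕₚ.*-assoc p N (q ℕ.* s)) (∣m⇒∣m*n (q ℕ.* s) r∣)) qs∣
  where
  expand : ∀ c d p → (1 ℕ.+ c ℕ.* p) ℕ.* (1 ℕ.+ d ℕ.* p) ≡ 1 ℕ.+ (c ℕ.+ d ℕ.+ c ℕ.* p ℕ.* d) ℕ.* p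
  expand = solve-∀

∈⇒∣product : ∀ {q qs} → q ∈ qs → q ∣ product qs
∈⇒∣product {qs = _ ∷ qs} (here ≡.refl) = m∣m*n (product qs)
∈⇒∣product {qs = r ∷ _} (there q∈) = ∣n⇒∣m*n r (∈⇒∣product q∈)

-- Subgroups of an abelian group and congruence modulo them

module AbelianTheory (G : FiniteGroup) (comm : IsAbelian G) where
  open FiniteGroup G

  abelianGroup : AbelianGroup 0ℓ 0ℓ
  abelianGroup = record { isAbelianGroup = record { isGroup = isGroup ; comm = comm } }

  open import Algebra.Properties.AbelianGroup abelianGroup public
  -- n · x is the n-th power of x.
  open import Algebra.Properties.CommutativeMonoid.Mult (AbelianGroup.commutativeMonoid abelianGroup)
    public renaming (_×_ to _·_)
  open import Algebra.Properties.CommutativeSemigroup (AbelianGroup.commutativeSemigroup abelianGroup)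
    public using (interchange)
  open import Relation.Binary.Reasoning.Setoid setoid

  \\-∙ : ∀ a b x y → (a ∙ b) \\ (x ∙ y) ≈ (a \\ x) ∙ (b \\ y)
  \\-∙ a b x y = trans (∙-congʳ (sym (⁻¹-∙-comm a b))) (interchange (a ⁻¹) (b ⁻¹) x y)

  \\≈// : ∀ x y → x \\ y ≈ y // x
  \\≈// = comm⇒\\≗flip-// comm

  ε\\ : ∀ x → ε \\ x ≈ x
  ε\\ x = trans (∙-congʳ ε⁻¹≈ε) (identityˡ x)

  //ε : ∀ x → x // ε ≈ x
  //ε x = trans (∙-congˡ ε⁻¹≈ε) (identityʳ x)

  \\-∙\\ : ∀ x y z → (x \\ y) ∙ (y \\ z) ≈ x \\ z
  \\-∙\\ x y z = trans (assoc _ _ _) (∙-congˡ (\\-leftDividesˡ y z))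

  //-cancelʳ : ∀ x y z → (x // z) // (y // z) ≈ x // y
  //-cancelʳ x y z = trans (∙-congˡ (⁻¹-anti-homo-// y z)) (trans (assoc _ _ _) (∙-congˡ (\\-leftDividesʳ z (y ⁻¹))))

  \\≈ε⇒≈ : ∀ {x y} → x \\ y ≈ ε → x ≈ y
  \\≈ε⇒≈ {x} {y} e = trans (trans (sym (identityʳ x)) (∙-congˡ (sym e))) (\\-leftDividesˡ x y)

  ≈⇒\\≈ε : ∀ {x y} → x ≈ y → x \\ y ≈ ε
  ≈⇒\\≈ε {x} {y} e = trans (∙-congˡ (sym e)) (inverseˡ x)

  ·ε≈ε : ∀ n → n · ε ≈ ε
  ·ε≈ε zero = refl
  ·ε≈ε (suc n) = trans (identityˡ _) (·ε≈ε n)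

  ∣⇒·≈ε : ∀ {d k b} → d · b ≈ ε → d ∣ k → k · b ≈ ε
  ∣⇒·≈ε {d} {_} {b} db (divides q ≡.refl) =
    trans (sym (×-assocˡ b q d)) (trans (×-congʳ q db) (·ε≈ε q))

  ∈-resp : ∀ {H} → IsSubgroup G H → ∀ {x y} → x ≈ y → T (H x) → T (H y)
  ∈-resp Hs e = ≡.subst T (IsSubgroup.resp Hs e)

  infix 4 _≈[_]_
  -- Unfolds to the same type as `_≡L_` for every U, so facts about cosets pass between sections
  -- without conversion.
  _≈[_]_ : Carrier → Subset G → Carrier → Set
  x ≈[ H ] y = T (H (x ⁻¹ ∙ y))

  module Cosets {H : Subset G} (Hs : IsSubgroup G H) where
    open IsSubgroup Hs public using () renaming (ε∈ to ε-mem; ∙∈ to ∙-mem; ⁻¹∈ to ⁻¹-mem)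

    resp : ∀ {x y} → x ≈ y → T (H x) → T (H y)
    resp = ∈-resp Hs

    //-mem : ∀ x y → T (H x) → T (H y) → T (H (x // y))
    //-mem x y hx hy = ∙-mem _ _ hx (⁻¹-mem y hy)

    ·-mem : ∀ n {x} → T (H x) → T (H (n · x))
    ·-mem zero hx = ε-mem
    ·-mem (suc n) hx = ∙-mem _ _ hx (·-mem n hx)

    of-≈ : ∀ {x y} → x ≈ y → x ≈[ H ] y
    of-≈ e = resp (sym (≈⇒\\≈ε e)) ε-mem

    ≡-refl : ∀ {x} → x ≈[ H ] x
    ≡-refl = of-≈ refl

    ≡-sym : ∀ {x y} → x ≈[ H ] y → y ≈[ H ] x
    ≡-sym {x} {y} h = resp (⁻¹-anti-homo-\\ x y) (⁻¹-mem _ h)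

    ≡-trans : ∀ {x y z} → x ≈[ H ] y → y ≈[ H ] z → x ≈[ H ] z
    ≡-trans {x} {y} {z} h k = resp (\\-∙\\ x y z) (∙-mem _ _ h k)

    ≡-∙ : ∀ {a b x y} → a ≈[ H ] x → b ≈[ H ] y → (a ∙ b) ≈[ H ] (x ∙ y)
    ≡-∙ {a} {b} {x} {y} h k = resp (sym (\\-∙ a b x y)) (∙-mem _ _ h k)

    ≡-⁻¹ : ∀ {a x} → a ≈[ H ] x → (a ⁻¹) ≈[ H ] (x ⁻¹)
    ≡-⁻¹ {a} {x} h = resp (sym (⁻¹-∙-comm (a ⁻¹) x)) (⁻¹-mem _ h)

    ≡-· : ∀ n {a x} → a ≈[ H ] x → (n · a) ≈[ H ] (n · x)
    ≡-· zero h = ≡-refl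
    ≡-· (suc n) h = ≡-∙ h (≡-· n h)

    ≡-mem : ∀ {x y} → x ≈[ H ] y → T (H x) → T (H y)
    ≡-mem {x} {y} h hx = resp (\\-leftDividesˡ x y) (∙-mem _ _ hx h)

    ε≡⇒mem : ∀ {x} → ε ≈[ H ] x → T (H x)
    ε≡⇒mem {x} = resp (ε\\ x)

    mem⇒ε≡ : ∀ {x} → T (H x) → ε ≈[ H ] x
    mem⇒ε≡ {x} = resp (sym (ε\\ x))

    -- The coset of a has order exactly p: if k were prime to p, a Bézout identity would write a
    -- through k · a and p · a, both in H.
    order : ∀ {p a k} → Prime p → T (H (p · a)) → ¬ T (H a) → T (H (k · a)) → p ∣ k
    order {p} {a} {k} pp pa a∉ ka with p ∣? k
    ... | yes p∣k = p∣k
    ... | no p∤k = ⊥-elim (a∉ (a∈ (coprime-Bézout (prime-coprime pp p∤k))))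
      where
      multiple : ∀ d q → T (H (d · a)) → T (H ((q ℕ.* d) · a))
      multiple d q h = resp (×-assocˡ a q d) (·-mem q h)
      cancel : ∀ {n m} → 1 ℕ.+ n ≡ m → T (H (n · a)) → T (H (m · a)) → T (H a)
      cancel {n} ≡.refl hn hm = resp (//-rightDividesʳ (n · a) a) (//-mem _ _ hm hn)
      a∈ : Bézout.Identity 1 k p → T (H a)
      a∈ (Bézout.+- x y eq) = cancel eq (multiple p y pa) (multiple k x ka)
      a∈ (Bézout.-+ x y eq) = cancel eq (multiple k x ka) (multiple p y pa)

  full-subgroup : IsSubgroup G (full G)
  full-subgroup = record { resp = λ _ → ≡.refl ; ε∈ = tt ; ∙∈ = λ _ _ _ _ → tt ; ⁻¹∈ = λ _ _ → tt }

  ∈trivial⇒≈ε : ∀ {x} → T (trivial G x) → x ≈ ε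
  ∈trivial⇒≈ε {x} t with x ≟ ε
  ... | yes e = e

  ≈ε⇒∈trivial : ∀ {x} → x ≈ ε → T (trivial G x)
  ≈ε⇒∈trivial {x} e with x ≟ ε
  ... | yes _ = tt
  ... | no ¬e = ¬e e

  trivial-resp : ∀ {x y} → x ≈ y → trivial G x ≡ trivial G y
  trivial-resp {x} {y} e with x ≟ ε | y ≟ ε
  ... | yes _ | yes _ = ≡.refl
  ... | no _  | no _  = ≡.refl
  ... | yes a | no b  = contradiction (trans (sym e) a) b
  ... | no a  | yes b = contradiction (trans e b) a

  trivial-subgroup : IsSubgroup G (trivial G)
  trivial-subgroup = record
    { resp = trivial-resp
    ; ε∈ = ≈ε⇒∈trivial refl
    ; ∙∈ = λ x y tx ty → ≈ε⇒∈trivial (trans (∙-cong (∈trivial⇒≈ε tx) (∈trivial⇒≈ε ty)) (identityˡ ε))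
    ; ⁻¹∈ = λ x tx → ≈ε⇒∈trivial (trans (⁻¹-cong (∈trivial⇒≈ε tx)) ε⁻¹≈ε) }

  ≡trivial⇒≈ : ∀ {x y} → x ≈[ trivial G ] y → x ≈ y
  ≡trivial⇒≈ t = \\≈ε⇒≈ (∈trivial⇒≈ε t)

  ≈⇒≡trivial : ∀ {x y} → x ≈ y → x ≈[ trivial G ] y
  ≈⇒≡trivial e = ≈ε⇒∈trivial (≈⇒\\≈ε e)

  trivial⊆ : ∀ {H} → IsSubgroup G H → _⊆_ G (trivial G) H
  trivial⊆ Hs x tx = ∈-resp Hs (sym (∈trivial⇒≈ε tx)) (IsSubgroup.ε∈ Hs)

-- Adjoining an element of prime order to a subgroup

module Adjunction (G : FiniteGroup) (comm : IsAbelian G) where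
  open FiniteGroup G
  open AbelianTheory G comm
  open import Relation.Binary.Reasoning.Setoid setoid

  InSomeCoset : Subset G → Carrier → ℕ → Carrier → Set
  InSomeCoset H a p x = ∃ λ (i : Fin p) → T (H ((toℕ i · a) \\ x))

  inSomeCoset? : ∀ H a p x → Dec (InSomeCoset H a p x)
  inSomeCoset? H a p x = Fin.any? (λ i → T? (H ((toℕ i · a) \\ x)))

  -- H⟨a⟩ when a has order dividing p.
  adjoin : Subset G → Carrier → ℕ → Subset G
  adjoin H a p x = isYes (inSomeCoset? H a p x)

  -- Junk value 0 outside H⟨a⟩.
  exponent : Subset G → Carrier → ℕ → Carrier → ℕ
  exponent H a p x with inSomeCoset? H a p x
  ... | yes (i , _) = toℕ i
  ... | no _ = 0

  -- Maps stay total on the carrier and are constrained only on H, so an extension to a larger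
  -- subgroup has the same type.
  record IsHomOn (H : Subset G) (θ : Carrier → Carrier) : Set where
    field
      cong-on : ∀ {x y} → T (H x) → T (H y) → x ≈ y → θ x ≈ θ y
      homo-on : ∀ {x y} → T (H x) → T (H y) → θ (x ∙ y) ≈ θ x ∙ θ y

  module _ {H} (Hs : IsSubgroup G H) where
    open Cosets Hs

    hom-ε : ∀ {θ} → IsHomOn H θ → θ ε ≈ ε
    hom-ε {θ} h = begin
      θ ε                  ≈⟨ \\-leftDividesʳ (θ ε) (θ ε) ⟨
      θ ε \\ (θ ε ∙ θ ε)   ≈⟨ ∙-congˡ (homo-on ε-mem ε-mem) ⟨
      θ ε \\ θ (ε ∙ ε)     ≈⟨ ∙-congˡ (cong-on (∙-mem _ _ ε-mem ε-mem) ε-mem (identityˡ ε)) ⟩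
      θ ε \\ θ ε           ≈⟨ inverseˡ (θ ε) ⟩
      ε                    ∎
      where open IsHomOn h

    hom-· : ∀ {θ} → IsHomOn H θ → ∀ n {x} → T (H x) → θ (n · x) ≈ n · θ x
    hom-· h zero hx = hom-ε h
    hom-· h (suc n) hx = trans (IsHomOn.homo-on h hx (·-mem n hx)) (∙-congˡ (hom-· h n hx))

    hom-⁻¹ : ∀ {θ} → IsHomOn H θ → ∀ {x} → T (H x) → θ (x ⁻¹) ≈ (θ x) ⁻¹
    hom-⁻¹ {θ} h {x} hx = inverseˡ-unique (θ (x ⁻¹)) (θ x) (begin
      θ (x ⁻¹) ∙ θ x   ≈⟨ homo-on (⁻¹-mem _ hx) hx ⟨
      θ (x ⁻¹ ∙ x)     ≈⟨ cong-on (∙-mem _ _ (⁻¹-mem _ hx) hx) ε-mem (inverseˡ x) ⟩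
      θ ε              ≈⟨ hom-ε h ⟩
      ε                ∎)
      where open IsHomOn h

    hom-// : ∀ {θ} → IsHomOn H θ → ∀ {x y} → T (H x) → T (H y) → θ (x // y) ≈ θ x // θ y
    hom-// h hx hy = trans (IsHomOn.homo-on h hx (⁻¹-mem _ hy)) (∙-congˡ (hom-⁻¹ h hy))

  module Adjoin {H : Subset G} (Hs : IsSubgroup G H) {a : Carrier} {p : ℕ}
                (pp : Prime p) (pa : p · a ≈ ε) where
    open Cosets Hs

    H⁺ : Subset G
    H⁺ = adjoin H a p

    adjoin⁻ : ∀ {x} → T (H⁺ x) → T (H ((exponent H a p x · a) \\ x))
    adjoin⁻ {x} t with inSomeCoset? H a p x
    ... | yes (_ , h) = h

    instance
      p≢0 : NonZero p
      p≢0 = prime⇒nonZero pp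

    reduce : ∀ {b} → p · b ≈ ε → ∀ i → (i % p) · b ≈ i · b
    reduce {b} pb i = begin
      (i % p) · b                          ≈⟨ identityʳ _ ⟨
      (i % p) · b ∙ ε                      ≈⟨ ∙-congˡ (∣⇒·≈ε pb (n∣m*n (i / p))) ⟨
      (i % p) · b ∙ (i / p ℕ.* p) · b      ≈⟨ ×-homo-+ b (i % p) (i / p ℕ.* p) ⟨
      (i % p ℕ.+ i / p ℕ.* p) · b          ≈⟨ ×-congˡ (m≡m%n+[m/n]*n i p) ⟨
      i · b                                ∎

    -- The search in `adjoin` covers only exponents below p; since p · a ≈ ε, any natural number may
    -- be reduced modulo p first.
    adjoin⁺ : ∀ i {x} → (i · a) ≈[ H ] x → T (H⁺ x)
    adjoin⁺ i {x} h with inSomeCoset? H a p x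
    ... | yes _ = tt
    ... | no none = none (fromℕ< (m%n<n i p) , resp (∙-congʳ (⁻¹-cong lem)) h)
      where
      lem : i · a ≈ toℕ (fromℕ< (m%n<n i p)) · a
      lem = trans (sym (reduce pa i)) (×-congˡ (≡.sym (Fin.toℕ-fromℕ< (m%n<n i p))))

    ⊆adjoin : _⊆_ G H H⁺
    ⊆adjoin x hx = adjoin⁺ 0 (mem⇒ε≡ hx)

    ∈adjoin : T (H⁺ a)
    ∈adjoin = adjoin⁺ 1 (of-≈ (identityʳ a))

    adjoin-resp-T : ∀ {x y} → x ≈ y → T (H⁺ x) → T (H⁺ y)
    adjoin-resp-T {x} e t = adjoin⁺ (exponent H a p x) (resp (∙-congˡ e) (adjoin⁻ t))

    exponent-sum : ∀ {x y} i j → (i · a) ≈[ H ] x → (j · a) ≈[ H ] y → ((i ℕ.+ j) · a) ≈[ H ] (x ∙ y)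
    exponent-sum i j h k = ≡-trans (of-≈ (×-homo-+ a i j)) (≡-∙ h k)

    -- With natural exponents, -i is represented by (p - 1) i, because i + (p - 1) i = p i.
    exponent-inverse : ∀ {x} i → (i · a) ≈[ H ] x → ((ℕ.pred p ℕ.* i) · a) ≈[ H ] (x ⁻¹)
    exponent-inverse {x} i h = ≡-trans (of-≈ eq) (≡-⁻¹ h)
      where
      eq : (ℕ.pred p ℕ.* i) · a ≈ (i · a) ⁻¹
      eq = inverseʳ-unique _ _ (begin
        i · a ∙ (ℕ.pred p ℕ.* i) · a    ≈⟨ ×-homo-+ a i (ℕ.pred p ℕ.* i) ⟨
        (suc (ℕ.pred p) ℕ.* i) · a      ≈⟨ ×-congˡ (≡.cong (ℕ._* i) (ℕₚ.suc-pred p)) ⟩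
        (p ℕ.* i) · a                   ≈⟨ ∣⇒·≈ε {d = p} {b = a} pa (m∣m*n i) ⟩
        ε                               ∎)

    adjoin-subgroup : IsSubgroup G H⁺
    adjoin-subgroup = record
      { resp = λ e → T-ext (adjoin-resp-T e) (adjoin-resp-T (sym e))
      ; ε∈ = ⊆adjoin ε ε-mem
      ; ∙∈ = λ x y tx ty → adjoin⁺ (exponent H a p x ℕ.+ exponent H a p y)
                              (exponent-sum (exponent H a p x) _ (adjoin⁻ tx) (adjoin⁻ ty))
      ; ⁻¹∈ = λ x tx → adjoin⁺ (ℕ.pred p ℕ.* exponent H a p x)
                          (exponent-inverse (exponent H a p x) (adjoin⁻ tx)) }

    adjoin-⊆ : ∀ {B} → IsSubgroup G B → _⊆_ G H B → T (B a) → _⊆_ G H⁺ B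
    adjoin-⊆ Bs H⊆B Ba x tx =
      Cosets.resp Bs (\\-leftDividesˡ _ x)
        (Cosets.∙-mem Bs _ _ (Cosets.·-mem Bs (exponent H a p x) Ba) (H⊆B _ (adjoin⁻ tx)))

    module Independent (a∉H : ¬ T (H a)) where

      exponent-∣-≤ : ∀ {i j} → i ≤ j → (i · a) ≈[ H ] (j · a) → p ∣ j ℕ.∸ i
      exponent-∣-≤ {i} {j} i≤j h = order pp (resp (sym pa) ε-mem) a∉H (resp eq h)
        where
        eq : (i · a) \\ (j · a) ≈ (j ℕ.∸ i) · a
        eq = trans (∙-congˡ (trans (×-congˡ (≡.sym (ℕₚ.m+[n∸m]≡n i≤j))) (×-homo-+ a i (j ℕ.∸ i))))
                   (\\-leftDividesʳ _ _)

      multiple-shift : ∀ {b} → p · b ≈ ε → ∀ {i j} → i ≤ j → p ∣ j ℕ.∸ i → i · b ≈ j · b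
      multiple-shift {b} pb {i} {j} i≤j d = begin
        i · b                     ≈⟨ identityʳ _ ⟨
        i · b ∙ ε                 ≈⟨ ∙-congˡ (∣⇒·≈ε pb d) ⟨
        i · b ∙ (j ℕ.∸ i) · b     ≈⟨ ×-homo-+ b i (j ℕ.∸ i) ⟨
        (i ℕ.+ (j ℕ.∸ i)) · b     ≈⟨ ×-congˡ (ℕₚ.m+[n∸m]≡n i≤j) ⟩
        j · b                     ∎

      -- Two exponents of x differ by a multiple of p, as a has order p modulo H, and such a
      -- multiple kills b. Hence a may be sent to any b killed by p.
      exponent-well-defined : ∀ {b} → p · b ≈ ε → ∀ {x} i j →
        (i · a) ≈[ H ] x → (j · a) ≈[ H ] x → i · b ≈ j · b
      exponent-well-defined {b} pb i j hi hj with ℕₚ.≤-total i j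
      ... | inj₁ i≤j = multiple-shift pb i≤j (exponent-∣-≤ i≤j (≡-trans hi (≡-sym hj)))
      ... | inj₂ j≤i = sym (multiple-shift pb j≤i (exponent-∣-≤ j≤i (≡-trans hj (≡-sym hi))))

      exponent-unique : (i j : Fin p) → (toℕ i · a) ≈[ H ] (toℕ j · a) → i ≡ j
      exponent-unique i j h = Fin.toℕ-injective (unique (Fin.toℕ<n i) (Fin.toℕ<n j) h)
        where
        ≤-unique : ∀ {i j} → i ≤ j → j < p → p ∣ j ℕ.∸ i → i ≡ j
        ≤-unique {i} {j} i≤j j<p d with j ℕ.∸ i in eq
        ... | zero = ℕₚ.≤-antisym i≤j (ℕₚ.m∸n≡0⇒m≤n eq)
        ... | suc k = contradiction (∣⇒≤ d)
                        (ℕₚ.<⇒≱ (ℕₚ.≤-<-trans (ℕₚ.≤-trans (ℕₚ.≤-reflexive (≡.sym eq)) (ℕₚ.m∸n≤m j i)) j<p))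
        unique : ∀ {i j} → i < p → j < p → (i · a) ≈[ H ] (j · a) → i ≡ j
        unique {i} {j} i<p j<p h with ℕₚ.≤-total i j
        ... | inj₁ i≤j = ≤-unique i≤j j<p (exponent-∣-≤ i≤j h)
        ... | inj₂ j≤i = ≡.sym (≤-unique j≤i i<p (exponent-∣-≤ j≤i (≡-sym h)))

      module ExtendHom {θ : Carrier → Carrier} (θ-hom : IsHomOn H θ) {b : Carrier} (pb : p · b ≈ ε) where
        open IsHomOn θ-hom

        θ⁺ : Carrier → Carrier
        θ⁺ x = θ ((exponent H a p x · a) \\ x) ∙ (exponent H a p x · b)

        -- Frees `θ⁺` from the exponent chosen by `exponent`; in the proof of additivity the
        -- exponents of x and y can then be added without reduction modulo p.
        extend-at : ∀ i {x} → (i · a) ≈[ H ] x → θ⁺ x ≈ θ ((i · a) \\ x) ∙ (i · b)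
        extend-at i {x} h = ∙-cong
          (cong-on (adjoin⁻ (adjoin⁺ i h)) h (∙-congʳ (⁻¹-cong (same pa))))
          (same pb)
          where
          same : ∀ {c} → p · c ≈ ε → exponent H a p x · c ≈ i · c
          same pc = exponent-well-defined pc (exponent H a p x) i (adjoin⁻ (adjoin⁺ i h)) h

        extend-hom : IsHomOn H⁺ θ⁺
        extend-hom = record { cong-on = cong⁺ ; homo-on = homo⁺ }
          where
          cong⁺ : ∀ {x y} → T (H⁺ x) → T (H⁺ y) → x ≈ y → θ⁺ x ≈ θ⁺ y
          cong⁺ {x} {y} tx ty e = sym (trans (extend-at (exponent H a p x) (resp (∙-congˡ e) (adjoin⁻ tx)))
            (∙-congʳ (cong-on (resp (∙-congˡ e) (adjoin⁻ tx)) (adjoin⁻ tx) (∙-congˡ (sym e)))))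
          homo⁺ : ∀ {x y} → T (H⁺ x) → T (H⁺ y) → θ⁺ (x ∙ y) ≈ θ⁺ x ∙ θ⁺ y
          homo⁺ {x} {y} tx ty = begin
            θ⁺ (x ∙ y)                                              ≈⟨ extend-at (i ℕ.+ j) h ⟩
            θ (((i ℕ.+ j) · a) \\ (x ∙ y)) ∙ ((i ℕ.+ j) · b)        ≈⟨ ∙-cong (cong-on h (∙-mem _ _ hx hy) split) (×-homo-+ b i j) ⟩
            θ (((i · a) \\ x) ∙ ((j · a) \\ y)) ∙ (i · b ∙ j · b)     ≈⟨ ∙-congʳ (homo-on hx hy) ⟩
            (θ ((i · a) \\ x) ∙ θ ((j · a) \\ y)) ∙ (i · b ∙ j · b) ≈⟨ interchange _ _ _ _ ⟩
            θ⁺ x ∙ θ⁺ y                                             ∎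
            where
            i = exponent H a p x
            j = exponent H a p y
            hx = adjoin⁻ tx
            hy = adjoin⁻ ty
            h = exponent-sum i j hx hy
            split : ((i ℕ.+ j) · a) \\ (x ∙ y) ≈ ((i · a) \\ x) ∙ ((j · a) \\ y)
            split = trans (∙-congʳ (⁻¹-cong (×-homo-+ a i j))) (\\-∙ (i · a) (j · a) x y)

        extend-extends : ∀ {x} → T (H x) → θ⁺ x ≈ θ x
        extend-extends {x} hx = trans (extend-at 0 (mem⇒ε≡ hx))
          (trans (identityʳ _) (cong-on (mem⇒ε≡ hx) hx (ε\\ x)))

        extend-generator : θ⁺ a ≈ b
        extend-generator = begin
          θ⁺ a                          ≈⟨ extend-at 1 (of-≈ (identityʳ a)) ⟩
          θ ((1 · a) \\ a) ∙ (1 · b)    ≈⟨ ∙-cong (cong-on (of-≈ (identityʳ a)) ε-mem (≈⇒\\≈ε (identityʳ a))) (identityʳ b) ⟩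
          θ ε ∙ b                       ≈⟨ ∙-congʳ (hom-ε Hs θ-hom) ⟩
          ε ∙ b                         ≈⟨ identityˡ b ⟩
          b                             ∎

-- Induction on subgroups when the exponent is squarefree

module Extensions (G : FiniteGroup) (comm : IsAbelian G) where
  open FiniteGroup G
  open AbelianTheory G comm
  open Adjunction G comm
  open import Relation.Binary.Reasoning.Setoid setoid

  infix 4 _⊑_
  _⊑_ : Subset G → Subset G → Set
  _⊑_ = _⊆_ G

  -- The list may repeat a prime, so its product need not be squarefree; squarefreeness is expressed
  -- by `p-part`.
  record SquarefreeExponent : Set where
    field
      primes     : List ℕ
      all-prime  : All Prime primes
      exponent-· : ∀ g → product primes · g ≈ ε
      -- g ↦ N · g projects onto the p-primary component.
      p-part     : ∀ {p} → Prime p → ∃[ N ] ∃[ c ] (N ≡ 1 ℕ.+ c ℕ.* p) × (∀ g → p · (N · g) ≈ ε)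

  -- Shows that N · g and g are congruent modulo every subgroup that contains p · g.
  split-p-part : ∀ {p c N} → N ≡ 1 ℕ.+ c ℕ.* p → ∀ g → N · g ≈ g ∙ c · (p · g)
  split-p-part {p} {c} ≡.refl g = ∙-congˡ (sym (×-assocˡ g c p))

  prodF-cong : ∀ {k} {h h' : Fin k → Carrier} → (∀ i → h i ≈ h' i) → prodF G h ≈ prodF G h'
  prodF-cong {zero} e = refl
  prodF-cong {suc k} e = ∙-cong (e fzero) (prodF-cong (e ∘ fsuc))

  ·-prodF-ε : ∀ n {k} {h : Fin k → Carrier} → (∀ i → n · h i ≈ ε) → n · prodF G h ≈ ε
  ·-prodF-ε n {zero} e = ·ε≈ε n
  ·-prodF-ε n {suc k} e = trans (×-distrib-+ _ _ n) (trans (∙-cong (e fzero) (·-prodF-ε n (e ∘ fsuc))) (identityˡ ε))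

  pow≡· : ∀ x n → pow G x n ≡ n · x
  pow≡· x zero = ≡.refl
  pow≡· x (suc n) = ≡.cong (x ∙_) (pow≡· x n)

  squarefreeExponent : IsDirProdElemAb G → SquarefreeExponent
  squarefreeExponent (_ , k , E , Es , span , _) = record
    { primes = ps
    ; all-prime = ps-prime
    ; exponent-· = λ g → kills _ (λ i → ∈⇒∣product (∈-tabulate⁺ i)) g
    ; p-part = λ {p} pp → let N , c , N≡ , d = p-part-exponent pp ps ps-prime in
        N , c , N≡ , λ g → trans (×-assocˡ g p N) (kills _ (λ i → All.lookup d (∈-tabulate⁺ i)) g) }
    where
    prm : Fin k → ℕ
    prm i = proj₁ (proj₂ (Es i))
    ps = tabulate prm
    ps-prime : All Prime ps
    ps-prime = tabulate⁺ (λ i → proj₁ (proj₂ (proj₂ (Es i))))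
    kills : ∀ n → (∀ i → prm i ∣ n) → ∀ g → n · g ≈ ε
    kills n d g with span g
    ... | h , h∈ , g≈ = trans (×-congʳ n g≈) (·-prodF-ε n λ i →
            ∣⇒·≈ε (trans (reflexive (≡.sym (pow≡· (h i) (prm i)))) (proj₂ (proj₂ (proj₂ (Es i))) (h i) (h∈ i))) (d i))

  -- P is proof-relevant: it carries an enumeration in `index`, an isomorphism in `extend-iso` and a
  -- homomorphism in `glue`, each extended by one generator per step.
  module Climb (sq : SquarefreeExponent) {H₀ B : Subset G} (H₀s : IsSubgroup G H₀) (Bs : IsSubgroup G B)
    (H₀⊆B : H₀ ⊑ B) (P : Subset G → Set)
    (step : ∀ {H a p} → IsSubgroup G H → H₀ ⊑ H → H ⊑ B → T (B a) → ¬ T (H a)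
            → Prime p → p · a ≈ ε → P H → P (adjoin H a p)) where
    open SquarefreeExponent sq

    record Stage : Set where
      field
        H        : Subset G
        subgroup : IsSubgroup G H
        lower    : H₀ ⊑ H
        upper    : H ⊑ B
        property : P H
    open Stage

    -- Strip the primes of the exponent from a one at a time; each is adjoined through its primary part.
    absorb : ∀ ps → All Prime ps → ∀ {a} → T (B a) → (s : Stage) → T (H s (product ps · a))
           → Σ Stage λ s' → (H s ⊑ H s') × T (H s' a)
    absorb [] _ {a} Ba s h = s , (λ _ x → x) , ∈-resp (subgroup s) (identityʳ a) h
    absorb (p ∷ ps) (pp ∷ pps) {a} Ba s h
      with absorb ps pps (Cosets.·-mem Bs p Ba) s
             (∈-resp (subgroup s) (trans (×-congˡ (ℕₚ.*-comm p (product ps))) (sym (×-assocˡ a (product ps) p))) h)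
    ... | s₁ , s⊆ , pa∈ with T? (H s₁ a)
    ...   | yes a∈ = s₁ , s⊆ , a∈
    ...   | no a∉ with p-part pp
    ...     | N , c , N≡ , kill = s₂ , (λ x hx → ⊆adjoin x (s⊆ x hx)) , a∈
      where
      open Cosets (subgroup s₁)
      open Adjoin (subgroup s₁) pp (kill a) using (⊆adjoin; ∈adjoin; adjoin-subgroup; adjoin-⊆)
      -- The recursive call has put p · a into H s₁, so a and N · a generate the same subgroup over
      -- it; of the two, N · a is certain to be killed by p.
      Na-split : (N · a) // (c · (p · a)) ≈ a
      Na-split = trans (∙-congʳ (split-p-part {p} {c} N≡ a)) (//-rightDividesʳ _ a)
      Na∉ : ¬ T (H s₁ (N · a))
      Na∉ h = a∉ (resp Na-split (//-mem _ _ h (·-mem c pa∈)))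
      s₂ : Stage
      s₂ = record
        { H = adjoin (H s₁) (N · a) p
        ; subgroup = adjoin-subgroup
        ; lower = λ x hx → ⊆adjoin x (lower s₁ x hx)
        ; upper = adjoin-⊆ Bs (upper s₁) (Cosets.·-mem Bs N Ba)
        ; property = step (subgroup s₁) (lower s₁) (upper s₁) (Cosets.·-mem Bs N Ba) Na∉ pp (kill a) (property s₁) }
      a∈ : T (H s₂ a)
      a∈ = Cosets.resp adjoin-subgroup Na-split
        (Cosets.//-mem adjoin-subgroup _ _ ∈adjoin (⊆adjoin _ (·-mem c pa∈)))

    absorb-all : (xs : List Carrier) → (s : Stage)
               → Σ Stage λ s' → (H s ⊑ H s') × All (λ x → T (B x) → T (H s' x)) xs
    absorb-all [] s = s , (λ _ h → h) , []
    absorb-all (x ∷ xs) s with absorb-all xs s | T? (B x)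
    ... | s₁ , s⊆ , all | no ¬Bx = s₁ , s⊆ , (λ Bx → contradiction Bx ¬Bx) ∷ all
    ... | s₁ , s⊆ , all | yes Bx
      with absorb primes all-prime Bx s₁
             (∈-resp (subgroup s₁) (sym (exponent-· x)) (IsSubgroup.ε∈ (subgroup s₁)))
    ...   | s₂ , s₁⊆ , x∈ = s₂ , (λ y h → s₁⊆ y (s⊆ y h)) , (λ _ → x∈) ∷ All.map (λ f Bx → s₁⊆ _ (f Bx)) all

    climb : P H₀ → Σ Stage λ s → B ⊑ H s
    climb P₀ with absorb-all elems (record { H = H₀ ; subgroup = H₀s ; lower = λ _ h → h ; upper = H₀⊆B ; property = P₀ })
    ... | s , _ , all = s , λ x Bx → reach Bx all (complete x)
      where
      reach : ∀ {x xs} → T (B x) → All (λ x → T (B x) → T (H s x)) xs → Any (x ≈_) xs → T (H s x)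
      reach Bx (f ∷ _) (here e) = ∈-resp (subgroup s) (sym e) (f (∈-resp Bs e Bx))
      reach Bx (_ ∷ fs) (there i) = reach Bx fs i

  -- The order of H as a bijection with Fin n; `elems` may list an element several times, so its
  -- length does not measure the order.
  record Enum (H : Subset G) (n : ℕ) : Set where
    field
      enc     : Carrier → Fin n
      dec     : Fin n → Carrier
      dec∈    : ∀ i → T (H (dec i))
      dec-inj : ∀ {i j} → dec i ≈ dec j → i ≡ j
      dec-enc : ∀ {x} → T (H x) → dec (enc x) ≈ x

    enc-inj : ∀ {x y} → T (H x) → T (H y) → enc x ≡ enc y → x ≈ y
    enc-inj hx hy e = trans (sym (dec-enc hx)) (trans (reflexive (≡.cong dec e)) (dec-enc hy))

  enum-trivial : Enum (trivial G) 1
  enum-trivial = record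
    { enc = λ _ → fzero ; dec = λ _ → ε ; dec∈ = λ _ → IsSubgroup.ε∈ trivial-subgroup
    ; dec-inj = λ { {fzero} {fzero} _ → ≡.refl } ; dec-enc = λ t → sym (∈trivial⇒≈ε t) }

  enum-≤ : ∀ {H H' m n} → H ⊑ H' → Enum H m → Enum H' n → m ≤ n
  enum-≤ H⊆ e e' = Fin.injective⇒≤ {f = Enum.enc e' ∘ Enum.dec e}
    (λ {i} {j} eq → Enum.dec-inj e (Enum.enc-inj e' (H⊆ _ (Enum.dec∈ e i)) (H⊆ _ (Enum.dec∈ e j)) eq))

  enum-unique : ∀ {H m n} → Enum H m → Enum H n → m ≡ n
  enum-unique e e' = ℕₚ.≤-antisym (enum-≤ (λ _ h → h) e e') (enum-≤ (λ _ h → h) e' e)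

  enum-bijection : ∀ {H H' n} {f g : Carrier → Carrier} → (∀ {x} → T (H x) → T (H' (f x))) → (∀ {x} → T (H' x) → T (H (g x)))
    → (∀ {x y} → T (H x) → T (H y) → f x ≈ f y → x ≈ y) → (∀ {x y} → T (H x) → T (H y) → x ≈ y → f x ≈ f y)
    → (∀ {x} → T (H' x) → f (g x) ≈ x) → Enum H n → Enum H' n
  enum-bijection {f = f} {g} f∈ g∈ f-inj f-cong fg e = record
    { enc = enc ∘ g ; dec = f ∘ dec ; dec∈ = λ i → f∈ (dec∈ i)
    ; dec-inj = λ {i} {j} eq → dec-inj (f-inj (dec∈ i) (dec∈ j) eq)
    ; dec-enc = λ hx → trans (f-cong (dec∈ _) (g∈ hx) (dec-enc (g∈ hx))) (fg hx) }
    where open Enum e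

  enum-≐ : ∀ {H H' n} → H ⊑ H' → H' ⊑ H → Enum H n → Enum H' n
  enum-≐ H⊆ ⊆H = enum-bijection {f = id} {g = id} (H⊆ _) (⊆H _) (λ _ _ e → e) (λ _ _ e → e) (λ _ → refl)

  -- An element of H' outside H, put in front of the n elements of H, would give an injection of Fin
  -- (n + 1) into Fin n.
  enum-⊇ : ∀ {H H' n} → IsSubgroup G H → H ⊑ H' → Enum H n → Enum H' n → H' ⊑ H
  enum-⊇ {H} {H'} {n} Hs H⊆ e e' x hx with T? (H x)
  ... | yes h = h
  ... | no x∉ = contradiction (Fin.injective⇒≤ {f = f} (λ {i} {j} → f-inj i j)) (ℕₚ.<⇒≱ (ℕₚ.n<1+n n))
    where
    open Enum
    f : Fin (suc n) → Fin n
    f fzero = enc e' x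
    f (fsuc i) = enc e' (dec e i)
    x≉ : ∀ i → ¬ (enc e' x ≡ enc e' (dec e i))
    x≉ i eq = x∉ (∈-resp Hs (sym (enc-inj e' hx (H⊆ _ (dec∈ e i)) eq)) (dec∈ e i))
    f-inj : ∀ i j → f i ≡ f j → i ≡ j
    f-inj fzero fzero _ = ≡.refl
    f-inj fzero (fsuc j) eq = contradiction eq (x≉ j)
    f-inj (fsuc i) fzero eq = contradiction (≡.sym eq) (x≉ i)
    f-inj (fsuc i) (fsuc j) eq = ≡.cong fsuc (dec-inj e (enc-inj e' (H⊆ _ (dec∈ e i)) (H⊆ _ (dec∈ e j)) eq))

  enum-adjoin : ∀ {H a p n} → IsSubgroup G H → ¬ T (H a) → Prime p → p · a ≈ ε → Enum H n → Enum (adjoin H a p) (p ℕ.* n)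
  enum-adjoin {H} {a} {p} {n} Hs a∉ pp pa e = record
    { enc = λ x → combine (index x) (enc ((toℕ (index x) · a) \\ x))
    ; dec = λ k → decode (remQuot n k)
    ; dec∈ = λ k → decode∈ (remQuot n k)
    ; dec-inj = λ {k} {l} eq → ≡.trans (≡.sym (Fin.combine-remQuot {p} n k))
        (≡.trans (≡.cong (λ r → combine (proj₁ r) (proj₂ r)) (decode-inj (remQuot n k) (remQuot n l) eq))
          (Fin.combine-remQuot {p} n l))
    ; dec-enc = λ {x} hx → trans (reflexive (≡.cong decode (Fin.remQuot-combine (index x) _)))
        (trans (∙-congˡ (dec-enc (index∈ hx))) (\\-leftDividesˡ _ x)) }
    where
    open Enum e
    open Cosets Hs
    open Adjoin Hs pp pa
    open Independent a∉
    -- `exponent` is a bare natural number with no stated bound, hence the remainder; it does not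
    -- change the multiple of a.
    index : Carrier → Fin p
    index x = fromℕ< (m%n<n (exponent H a p x) p)
    index· : ∀ x → toℕ (index x) · a ≈ exponent H a p x · a
    index· x = trans (×-congˡ (Fin.toℕ-fromℕ< (m%n<n (exponent H a p x) p))) (reduce pa (exponent H a p x))
    index∈ : ∀ {x} → T (adjoin H a p x) → T (H ((toℕ (index x) · a) \\ x))
    index∈ {x} hx = resp (∙-congʳ (⁻¹-cong (sym (index· x)))) (adjoin⁻ hx)
    decode : Fin p × Fin n → Carrier
    decode (i , j) = (toℕ i · a) ∙ dec j
    coset : ∀ i j → (toℕ i · a) ≈[ H ] decode (i , j)
    coset i j = resp (sym (\\-leftDividesʳ _ _)) (dec∈ j)
    decode∈ : ∀ k → T (adjoin H a p (decode k))
    decode∈ (i , j) = adjoin⁺ (toℕ i) (coset i j)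
    decode-inj : ∀ k l → decode k ≈ decode l → k ≡ l
    decode-inj (i , j) (i' , j') eq
      with exponent-unique i i' (≡-trans (coset i j) (≡-sym (≡-trans (coset i' j') (of-≈ (sym eq)))))
    ... | ≡.refl = ≡.cong (i ,_) (dec-inj (trans (sym (\\-leftDividesʳ _ _)) (trans (∙-congˡ eq) (\\-leftDividesʳ _ _))))

  record PartialIso (H H' : Subset G) : Set where
    field
      to from  : Carrier → Carrier
      to-hom   : IsHomOn H to
      from-hom : IsHomOn H' from
      to∈      : ∀ {x} → T (H x) → T (H' (to x))
      from∈    : ∀ {x} → T (H' x) → T (H (from x))
      from-to  : ∀ {x} → T (H x) → from (to x) ≈ x
      to-from  : ∀ {x} → T (H' x) → to (from x) ≈ x

    to-injective : ∀ {x y} → T (H x) → T (H y) → to x ≈ to y → x ≈ y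
    to-injective hx hy e = trans (sym (from-to hx)) (trans (IsHomOn.cong-on from-hom (to∈ hx) (to∈ hy) e) (from-to hy))

  swap : ∀ {H H'} → PartialIso H H' → PartialIso H' H
  swap π = record { to = from ; from = to ; to-hom = from-hom ; from-hom = to-hom
                  ; to∈ = from∈ ; from∈ = to∈ ; from-to = to-from ; to-from = from-to }
    where open PartialIso π

  id-hom : ∀ {H} → IsHomOn H id
  id-hom = record { cong-on = λ _ _ e → e ; homo-on = λ _ _ → refl }

  id-iso : ∀ {H} → PartialIso H H
  id-iso = record { to = id ; from = id ; to-hom = id-hom ; from-hom = id-hom ; to∈ = id ; from∈ = id
                  ; from-to = λ _ → refl ; to-from = λ _ → refl }

  hom-⊆ : ∀ {H K θ} → K ⊑ H → IsHomOn H θ → IsHomOn K θ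
  hom-⊆ K⊆ h = record { cong-on = λ x y → cong-on (K⊆ _ x) (K⊆ _ y) ; homo-on = λ x y → homo-on (K⊆ _ x) (K⊆ _ y) }
    where open IsHomOn h

  iso-≐ : ∀ {H H' K K'} → H ⊑ K → K ⊑ H → H' ⊑ K' → K' ⊑ H' → PartialIso H H' → PartialIso K K'
  iso-≐ HK KH HK' KH' π = record
    { to = to ; from = from ; to-hom = hom-⊆ KH to-hom ; from-hom = hom-⊆ KH' from-hom
    ; to∈ = λ k → HK' _ (to∈ (KH _ k)) ; from∈ = λ k → HK _ (from∈ (KH' _ k))
    ; from-to = λ k → from-to (KH _ k) ; to-from = λ k → to-from (KH' _ k) }
    where open PartialIso π

  module AdjoinIso {p} (pp : Prime p) where
    module Half {H H' a b} (Hs : IsSubgroup G H) (H's : IsSubgroup G H') (a∉ : ¬ T (H a)) (b∉ : ¬ T (H' b))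
                (pa : p · a ≈ ε) (pb : p · b ≈ ε) (π : PartialIso H H') where
      open PartialIso π
      module A = Adjoin Hs pp pa
      module B = Adjoin H's pp pb
      module Â = A.Independent.ExtendHom a∉ to-hom pb
      module B̂ = B.Independent.ExtendHom b∉ from-hom pa

      to⁺∈ : ∀ {x} → T (adjoin H a p x) → T (adjoin H' b p (Â.θ⁺ x))
      to⁺∈ {x} t = B.adjoin⁺ (exponent H a p x)
        (∈-resp H's (sym (trans (∙-congˡ (comm _ _)) (\\-leftDividesʳ _ _))) (to∈ (A.adjoin⁻ t)))

      from⁺-to⁺ : ∀ {x} → T (adjoin H a p x) → B̂.θ⁺ (Â.θ⁺ x) ≈ x
      from⁺-to⁺ {x} t = begin
        B̂.θ⁺ (to h ∙ i · b)          ≈⟨ homo-on (B.⊆adjoin _ (to∈ hh)) (Cosets.·-mem B.adjoin-subgroup i B.∈adjoin) ⟩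
        B̂.θ⁺ (to h) ∙ B̂.θ⁺ (i · b)   ≈⟨ ∙-cong (B̂.extend-extends (to∈ hh)) (hom-· B.adjoin-subgroup B̂.extend-hom i B.∈adjoin) ⟩
        from (to h) ∙ i · B̂.θ⁺ b      ≈⟨ ∙-cong (from-to hh) (×-congʳ i B̂.extend-generator) ⟩
        h ∙ i · a                     ≈⟨ comm _ _ ⟩
        i · a ∙ h                     ≈⟨ \\-leftDividesˡ _ x ⟩
        x                             ∎
        where
        open IsHomOn B̂.extend-hom
        i = exponent H a p x
        h = (i · a) \\ x
        hh = A.adjoin⁻ t

    adjoin-iso : ∀ {H H' a b} (Hs : IsSubgroup G H) (H's : IsSubgroup G H') → ¬ T (H a) → ¬ T (H' b)
      → p · a ≈ ε → p · b ≈ ε → (π : PartialIso H H')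
      → Σ (PartialIso (adjoin H a p) (adjoin H' b p)) λ π⁺ →
          (∀ {x} → T (H x) → PartialIso.to π⁺ x ≈ PartialIso.to π x)
        × (∀ {x} → T (H' x) → PartialIso.from π⁺ x ≈ PartialIso.from π x)
    adjoin-iso Hs H's a∉ b∉ pa pb π = record
      { to = X.Â.θ⁺ ; from = X.B̂.θ⁺ ; to-hom = X.Â.extend-hom ; from-hom = X.B̂.extend-hom
      ; to∈ = X.to⁺∈ ; from∈ = Y.to⁺∈ ; from-to = X.from⁺-to⁺ ; to-from = Y.from⁺-to⁺ }
      , X.Â.extend-extends , X.B̂.extend-extends
      where
      module X = Half Hs H's a∉ b∉ pa pb π
      module Y = Half H's Hs b∉ a∉ pb pa (swap π)

  module WithExponent (sq : SquarefreeExponent) where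
    open SquarefreeExponent sq using (p-part)

    -- Stronger than Cauchy's theorem for B / H: b itself, and not only its coset, is killed by p.
    Cauchy : Subset G → Subset G → ℕ → Set
    Cauchy H B m = ∀ {p} → Prime p → p ∣ m → ∃[ b ] T (B b) × ¬ T (H b) × p · b ≈ ε

    -- Lagrange together with Cauchy's theorem for B / H.
    index : ∀ {H B n} → IsSubgroup G H → IsSubgroup G B → H ⊑ B → Enum H n
      → ∃[ m ] Enum B (m ℕ.* n) × Cauchy H B m
    index {H} {B} {n} Hs Bs H⊆B e with climb initial
      where
      P : Subset G → Set
      P K = ∃[ m ] Enum K (m ℕ.* n) × Cauchy H B m
      step : ∀ {K a p} → IsSubgroup G K → H ⊑ K → K ⊑ B → T (B a) → ¬ T (K a)
            → Prime p → p · a ≈ ε → P K → P (adjoin K a p)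
      -- The new index is q m: a prime divisor equals q, and then a is the witness, or it divides m
      -- and was treated before.
      step {K} {a} {q} Ks H⊆K _ Ba a∉ pq qa (m , eK , cauchy) =
        q ℕ.* m , ≡.subst (Enum _) (≡.sym (ℕₚ.*-assoc q m n)) (enum-adjoin Ks a∉ pq qa eK) , λ pp p∣ → case pp (euclidsLemma q m pp p∣)
        where
        case : ∀ {p} → Prime p → (p ∣ q) ⊎ (p ∣ m) → ∃[ b ] T (B b) × ¬ T (H b) × p · b ≈ ε
        case pp (inj₁ p∣q) with prime∣prime⇒≡ pp pq p∣q
        ... | ≡.refl = a , Ba , (λ h → a∉ (H⊆K a h)) , qa
        case pp (inj₂ p∣m) = cauchy pp p∣m
      open Climb sq Hs Bs H⊆B P step
      initial : P H
      initial = 1 , ≡.subst (Enum H) (≡.sym (ℕₚ.*-identityˡ n)) e , λ pp p∣1 → contradiction (≡.subst Prime (∣1⇒≡1 p∣1) pp) ¬prime[1]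
    ... | s , B⊆ with Climb.Stage.property s
    ...   | m , eK , cauchy = m , enum-≐ (Climb.Stage.upper s) B⊆ eK , cauchy

    enumerate : ∀ {B} → IsSubgroup G B → ∃[ n ] Enum B n
    enumerate Bs with index trivial-subgroup Bs (trivial⊆ Bs) enum-trivial
    ... | m , e , _ = m ℕ.* 1 , e

    -- p divides |B : H| = |B' : H'|.
    matching-generator : ∀ {H H' B B' N a p} → IsSubgroup G H → IsSubgroup G B → IsSubgroup G H' → IsSubgroup G B'
      → H ⊑ B → H' ⊑ B' → Enum B N → Enum B' N → T (B a) → ¬ T (H a) → Prime p → p · a ≈ ε
      → PartialIso H H' → ∃[ b ] T (B' b) × ¬ T (H' b) × p · b ≈ ε
    matching-generator {H} {H'} {B} {B'} {N} {a} {p} Hs Bs H's Bs' H⊆B H'⊆B' eB eB' Ba a∉ pp pa ρ =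
      let n , eH = enumerate Hs
          m , em , _ = index A.adjoin-subgroup Bs (A.adjoin-⊆ Bs H⊆B Ba) (enum-adjoin Hs a∉ pp pa eH)
          m' , em' , cauchy = index H's Bs' H'⊆B' (enum-bijection to∈ from∈ to-injective (IsHomOn.cong-on to-hom) to-from eH)
      in cauchy pp (divides m (m'≡ {m} {m'} n eH em em'))
      where
      open PartialIso ρ
      module A = Adjoin Hs pp pa
      m'≡ : ∀ {m m'} n → Enum H n → Enum B (m ℕ.* (p ℕ.* n)) → Enum B' (m' ℕ.* n) → m' ≡ m ℕ.* p
      -- An order is never 0, because `enc` would send ε into Fin 0; this permits cancelling n
      -- below.
      m'≡ zero eH _ _ with Enum.enc eH ε
      ... | ()
      m'≡ {m} {m'} n@(suc _) _ em em' = ℕₚ.*-cancelʳ-≡ m' (m ℕ.* p) n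
        (≡.trans (enum-unique em' eB') (≡.trans (enum-unique eB em) (≡.sym (ℕₚ.*-assoc m p n))))

    -- Each new generator of order p on the side of B is matched with one on the side of B'. It
    -- exists because p divides both indices, which agree by the equality of orders.
    extend-iso : ∀ {H₀ H₀' B B' N} → IsSubgroup G H₀ → IsSubgroup G H₀' → IsSubgroup G B → IsSubgroup G B'
      → H₀ ⊑ B → H₀' ⊑ B' → Enum B N → Enum B' N → (π : PartialIso H₀ H₀')
      → Σ (PartialIso B B') λ π̂ →
          (∀ {x} → T (H₀ x) → PartialIso.to π̂ x ≈ PartialIso.to π x)
        × (∀ {x} → T (H₀' x) → PartialIso.from π̂ x ≈ PartialIso.from π x)
    extend-iso {H₀} {H₀'} {B} {B'} {N} H₀s H₀s' Bs Bs' H₀⊆B H₀⊆B' eB eB' π with climb initial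
      where
      P : Subset G → Set
      P H = ∃[ H' ] IsSubgroup G H' × (H₀' ⊑ H') × (H' ⊑ B') × Σ (PartialIso H H') λ π̂ →
          (∀ {x} → T (H₀ x) → PartialIso.to π̂ x ≈ PartialIso.to π x)
        × (∀ {x} → T (H₀' x) → PartialIso.from π̂ x ≈ PartialIso.from π x)
      step : ∀ {H a p} → IsSubgroup G H → H₀ ⊑ H → H ⊑ B → T (B a) → ¬ T (H a)
            → Prime p → p · a ≈ ε → P H → P (adjoin H a p)
      step {H} {a} {p} Hs H₀⊆ ⊆B Ba a∉ pp pa (H' , H's , H₀'⊆ , ⊆B' , ρ , toρ , fromρ) =
        let b , Bb , b∉ , pb = matching-generator Hs Bs H's Bs' ⊆B ⊆B' eB eB' Ba a∉ pp pa ρ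
            ρ⁺ , ext , ext' = AdjoinIso.adjoin-iso pp Hs H's a∉ b∉ pa pb ρ
            module A = Adjoin H's pp pb
        in adjoin H' b p , A.adjoin-subgroup , (λ x h → A.⊆adjoin x (H₀'⊆ x h)) , A.adjoin-⊆ Bs' ⊆B' Bb , ρ⁺
           , (λ h → trans (ext (H₀⊆ _ h)) (toρ h)) , (λ h → trans (ext' (H₀'⊆ _ h)) (fromρ h))
      open Climb sq H₀s Bs H₀⊆B P step
      initial : P H₀
      initial = H₀' , H₀s' , (λ _ h → h) , H₀⊆B' , π , (λ _ → refl) , (λ _ → refl)
    ... | s , B⊆ with Climb.Stage.property s
    ...   | H' , H's , _ , ⊆B' , ρ , toρ , fromρ =
            -- The climb exhausts only the domain; H' is all of B' because |H'| = |B| = |B'|.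
            iso-≐ (Climb.Stage.upper s) B⊆ ⊆B' (enum-⊇ H's ⊆B' eH' eB') ρ , toρ , fromρ
      where
      eH' : Enum H' N
      eH' = enum-bijection (PartialIso.to∈ ρ) (PartialIso.from∈ ρ) (PartialIso.to-injective ρ)
              (IsHomOn.cong-on (PartialIso.to-hom ρ)) (PartialIso.to-from ρ) (enum-≐ B⊆ (Climb.Stage.upper s) eB)

    -- An adjoined a of order p goes to the p-primary part of ψ₂ a, which is congruent to ψ₂ a
    -- modulo L because p · a ≈ ε.
    glue : ∀ {U L} {ψ₁ ψ₂ : Carrier → Carrier} → IsSubgroup G U → (Ls : IsSubgroup G L) → IsHomOn U ψ₁
      → (∀ {x y} → x ≈[ L ] y → ψ₂ x ≈[ L ] ψ₂ y) → (∀ x y → ψ₂ (x ∙ y) ≈[ L ] (ψ₂ x ∙ ψ₂ y))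
      → (∀ {x} → T (U x) → ψ₁ x ≈[ L ] ψ₂ x)
      → ∃[ ψ ] IsHomOn (full G) ψ × (∀ {x} → T (U x) → ψ x ≈ ψ₁ x) × (∀ x → ψ x ≈[ L ] ψ₂ x)
    glue {U} {L} {ψ₁} {ψ₂} Us Ls hom₁ cong₂ homo₂ agree with climb initial
      where
      open Cosets Ls
      ψ₂-ε : ψ₂ ε ≈[ L ] ε
      ψ₂-ε = ≡-trans (of-≈ (sym (\\-leftDividesʳ (ψ₂ ε) (ψ₂ ε))))
             (≡-trans (≡-∙ ≡-refl (≡-sym (≡-trans (cong₂ (of-≈ (sym (identityˡ ε)))) (homo₂ ε ε)))) (of-≈ (inverseˡ _)))
      ψ₂-· : ∀ n x → ψ₂ (n · x) ≈[ L ] (n · ψ₂ x)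
      ψ₂-· zero x = ψ₂-ε
      ψ₂-· (suc n) x = ≡-trans (homo₂ x (n · x)) (≡-∙ ≡-refl (ψ₂-· n x))
      P : Subset G → Set
      P H = ∃[ θ ] IsHomOn H θ × (∀ {x} → T (U x) → θ x ≈ ψ₁ x) × (∀ {x} → T (H x) → θ x ≈[ L ] ψ₂ x)
      step : ∀ {H a p} → IsSubgroup G H → U ⊑ H → H ⊑ full G → T (full G a) → ¬ T (H a)
            → Prime p → p · a ≈ ε → P H → P (adjoin H a p)
      step {H} {a} {p} Hs U⊆ _ _ a∉ pp pa (θ , θ-hom , θ≈ , θ≡) with p-part pp
      ... | N , c , N≡ , kill = θ⁺ , extend-hom , (λ u → trans (extend-extends (U⊆ _ u)) (θ≈ u)) , θ⁺≡
        where
        b : Carrier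
        b = N · ψ₂ a
        open Adjoin Hs pp pa
        open Independent a∉
        open ExtendHom θ-hom {b} (kill (ψ₂ a))
        b≡ : b ≈[ L ] ψ₂ a
        b≡ = ≡-trans (of-≈ (split-p-part {p} {c} N≡ (ψ₂ a))) (≡-trans (≡-∙ ≡-refl (≡-· c
               (≡-trans (≡-sym (ψ₂-· p a)) (≡-trans (cong₂ (of-≈ pa)) ψ₂-ε)))) (of-≈ (trans (∙-congˡ (·ε≈ε c)) (identityʳ _))))
        θ⁺≡ : ∀ {x} → T (adjoin H a p x) → θ⁺ x ≈[ L ] ψ₂ x
        θ⁺≡ {x} t = ≡-trans (≡-∙ (θ≡ (adjoin⁻ t)) (≡-trans (≡-· i b≡) (≡-sym (ψ₂-· i a))))
          (≡-trans (≡-sym (homo₂ _ _)) (cong₂ (of-≈ (trans (comm _ _) (\\-leftDividesˡ _ x)))))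
          where i = exponent H a p x
      open Climb sq Us full-subgroup (λ _ _ → tt) P step
      initial : P U
      initial = ψ₁ , hom₁ , (λ _ → refl) , agree
    ... | s , ⊆H with Climb.Stage.property s
    ...   | θ , θ-hom , θ≈ , θ≡ = θ , hom-⊆ ⊆H θ-hom , θ≈ , λ x → θ≡ (⊆H x tt)

-- S-rings over a section and their images under permutations

lookup-distinct : ∀ {A : Set} {R : A → A → Set} → (∀ {x y} → R x y → R y x)
  → ∀ {xs} → AllPairs (λ x y → ¬ R x y) xs → ∀ i j → R (lookup xs i) (lookup xs j) → i ≡ j
lookup-distinct R-sym (_ ∷ _) fzero fzero _ = ≡.refl
lookup-distinct R-sym (x≉ ∷ _) fzero (fsuc j) r = contradiction r (All.lookup x≉ (∈-lookup j))
lookup-distinct R-sym (x≉ ∷ _) (fsuc i) fzero r = contradiction (R-sym r) (All.lookup x≉ (∈-lookup i))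
lookup-distinct R-sym (_ ∷ ps) (fsuc i) (fsuc j) r = ≡.cong fsuc (lookup-distinct R-sym ps i j r)

module Section (G : FiniteGroup) (comm : IsAbelian G) {U L : Subset G}
  (Us : IsSubgroup G U) (Ls : IsSubgroup G L) (L⊆U : _⊆_ G L U) where
  open FiniteGroup G
  open AbelianTheory G comm
  open Cosets Ls
  open Equivalence using () renaming (to to fwd; from to bwd)

  Rel : Set
  Rel = Carrier → Carrier → Bool

  module 𝑈 = Cosets Us

  In-≡ : ∀ {x y} → x ≈[ L ] y → T (U x) → T (U y)
  In-≡ h = 𝑈.≡-mem (L⊆U _ h)

  In-// : ∀ {x y} → T (U x) → T (U y) → T (U (x ∙ y ⁻¹))
  In-// = 𝑈.//-mem _ _

  ≡-// : ∀ {a b x y} → a ≈[ L ] x → b ≈[ L ] y → (a // b) ≈[ L ] (x // y)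
  ≡-// h k = ≡-∙ h (≡-⁻¹ k)

  id-perm : IsPerm G U L id
  id-perm = record { inv = id ; f-In = λ _ h → h ; inv-In = λ _ h → h ; f-cong = λ _ _ _ _ h → h
                   ; inv-cong = λ _ _ _ _ h → h ; left = λ _ _ → ≡-refl ; right = λ _ _ → ≡-refl }

  id-aut : IsAut G U L id
  id-aut = id-perm , λ _ _ _ _ → ≡-refl

  cosetSetoid : DecSetoid 0ℓ 0ℓ
  cosetSetoid = record
    { Carrier = Carrier ; _≈_ = _≈[ L ]_
    ; isDecEquivalence = record
      { isEquivalence = record { refl = ≡-refl ; sym = ≡-sym ; trans = ≡-trans }
      ; _≟_ = λ x y → T? (L (x ⁻¹ ∙ y)) } }

  -- The representatives for P are pairwise incongruent modulo L, so sending each to the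
  -- representative of its image is an injection of positions. `Q-resp` enters because `complete`
  -- finds g x in `elems` only up to `_≈_`.
  count-≤ : ∀ {P Q : Carrier → Bool} (g : Carrier → Carrier)
    → (∀ {x} → T (U x) → T (P x) → T (U (g x)) × T (Q (g x)))
    → (∀ {x y} → T (U x) → T (U y) → g x ≈[ L ] g y → x ≈[ L ] y)
    → (∀ {x y} → x ≈ y → T (U x) → T (Q x) → T (Q y))
    → count G U L P ≤ count G U L Q
  count-≤ {P} {Q} g g∈ g-inj Q-resp = Fin.injective⇒≤ {f = λ i → Any.index (image i)} λ {i} {j} eq →
      lookup-distinct ≡-sym (deduplicate-! cosetSetoid (selected P)) i j
        (g-inj (proj₁ (split i)) (proj₁ (split j)) (Memₚ.index-injective S (image i) (image j) eq))
    where
    S = DecSetoid.setoid cosetSetoid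
    selected : (Carrier → Bool) → List Carrier
    selected R = filterᵇ (λ x → U x ∧ R x) elems
    reps : (Carrier → Bool) → List Carrier
    reps R = deduplicateᵇ (λ x y → L (x ⁻¹ ∙ y)) (selected R)
    split : ∀ i → T (U (lookup (reps P) i)) × T (P (lookup (reps P) i))
    split i = fwd T-∧ (proj₂ (∈-filter⁻ (λ x → T? (U x ∧ P x)) {xs = elems}
      (∈-deduplicate⁻ _ (selected P) (∈-lookup {xs = reps P} i))))
    image : ∀ i → Mem._∈_ S (g (lookup (reps P) i)) (reps Q)
    image i = Memₚ.∈-deduplicate⁺ S _ (λ h k → ≡-trans k (≡-sym h)) (Any.map of-≈
      (Memₚ.∈-filter⁺ setoid (λ x → T? (U x ∧ Q x))
        (λ e t → bwd T-∧ (𝑈.resp e (proj₁ (fwd T-∧ t)) , Q-resp e (proj₁ (fwd T-∧ t)) (proj₂ (fwd T-∧ t))))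
        (complete _) (bwd T-∧ (g∈ (proj₁ (split i)) (proj₂ (split i))))))

  inv-injective : ∀ {f} (pf : IsPerm G U L f) → ∀ {x y} → T (U x) → T (U y) → IsPerm.inv pf x ≈[ L ] IsPerm.inv pf y → x ≈[ L ] y
  inv-injective pf {x} {y} ux uy h = ≡-trans (≡-sym (right x ux)) (≡-trans (f-cong _ _ (inv-In x ux) (inv-In y uy) h) (right y uy))
    where open IsPerm pf

  perm-injective : ∀ {f} (pf : IsPerm G U L f) → ∀ {x y} → T (U x) → T (U y) → f x ≈[ L ] f y → x ≈[ L ] y
  perm-injective pf {x} {y} ux uy h = ≡-trans (≡-sym (left x ux)) (≡-trans (inv-cong _ _ (f-In x ux) (f-In y uy) h) (left y uy))
    where open IsPerm pf

  comp-perm : ∀ {f g} → IsPerm G U L f → IsPerm G U L g → IsPerm G U L (g ∘ f)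
  comp-perm pf pg = record
    { inv = F.inv ∘ K.inv
    ; f-In = λ x u → K.f-In _ (F.f-In x u)
    ; inv-In = λ x u → F.inv-In _ (K.inv-In x u)
    ; f-cong = λ x y u v h → K.f-cong _ _ (F.f-In x u) (F.f-In y v) (F.f-cong x y u v h)
    ; inv-cong = λ x y u v h → F.inv-cong _ _ (K.inv-In x u) (K.inv-In y v) (K.inv-cong x y u v h)
    ; left = λ x u → ≡-trans (F.inv-cong _ _ (K.inv-In _ (K.f-In _ (F.f-In x u))) (F.f-In x u) (K.left _ (F.f-In x u))) (F.left x u)
    ; right = λ x u → ≡-trans (K.f-cong _ _ (F.f-In _ (F.inv-In _ (K.inv-In x u))) (K.inv-In x u) (F.right _ (K.inv-In x u))) (K.right x u) }
    where
    module F = IsPerm pf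
    module K = IsPerm pg

  inv-perm : ∀ {f} (pf : IsPerm G U L f) → IsPerm G U L (IsPerm.inv pf)
  inv-perm {f} pf = record { inv = f ; f-In = inv-In ; inv-In = f-In ; f-cong = inv-cong ; inv-cong = f-cong ; left = right ; right = left }
    where open IsPerm pf

  inv-aut : ∀ {f} ((pf , _) : IsAut G U L f) → IsAut G U L (IsPerm.inv pf)
  inv-aut {f} (pf , homo) = inv-perm pf , λ x y u v →
    ≡-trans (inv-cong _ _ (𝑈.∙-mem _ _ u v) (f-In _ (𝑈.∙-mem _ _ (inv-In x u) (inv-In y v)))
              (≡-sym (≡-trans (homo _ _ (inv-In x u) (inv-In y v)) (≡-∙ (right x u) (right y v)))))
            (left _ (𝑈.∙-mem _ _ (inv-In x u) (inv-In y v)))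
    where open IsPerm pf

  comp-aut : ∀ {f g} → IsAut G U L f → IsAut G U L g → IsAut G U L (g ∘ f)
  comp-aut (pf , hf) (pg , hg) = comp-perm pf pg , λ x y u v →
    ≡-trans (IsPerm.f-cong pg _ _ (F.f-In _ (𝑈.∙-mem _ _ u v)) (𝑈.∙-mem _ _ (F.f-In x u) (F.f-In y v)) (hf x y u v))
            (hg _ _ (F.f-In x u) (F.f-In y v))
    where module F = IsPerm pf

  aut-ε : ∀ {f} → IsAut G U L f → f ε ≈[ L ] ε
  aut-ε {f} (pf , homo) = ≡-trans (of-≈ (sym (\\-leftDividesʳ (f ε) (f ε))))
    (≡-trans (≡-∙ ≡-refl (≡-sym (≡-trans (IsPerm.f-cong pf _ _ 𝑈.ε-mem (𝑈.∙-mem _ _ 𝑈.ε-mem 𝑈.ε-mem) (of-≈ (sym (identityˡ ε))))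
      (homo ε ε 𝑈.ε-mem 𝑈.ε-mem)))) (of-≈ (inverseˡ _)))

  aut-⁻¹ : ∀ {f} → IsAut G U L f → ∀ x → T (U x) → f (x ⁻¹) ≈[ L ] ((f x) ⁻¹)
  aut-⁻¹ {f} a@(pf , homo) x u = ≡-trans (of-≈ (sym (//-rightDividesʳ (f x) (f (x ⁻¹)))))
    (≡-trans (≡-// (≡-trans (≡-sym (homo _ _ ux u)) (≡-trans (IsPerm.f-cong pf _ _ (𝑈.∙-mem _ _ ux u) 𝑈.ε-mem (of-≈ (inverseˡ x))) (aut-ε a))) ≡-refl)
      (of-≈ (identityˡ _)))
    where ux = 𝑈.⁻¹-mem x u

  aut-// : ∀ {f} → IsAut G U L f → ∀ x y → T (U x) → T (U y) → f (x ∙ y ⁻¹) ≈[ L ] (f x ∙ f y ⁻¹)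
  aut-// a@(_ , homo) x y u v = ≡-trans (homo _ _ u (𝑈.⁻¹-mem y v)) (≡-∙ ≡-refl (aut-⁻¹ a y v))

  -- An isomorphism of S-rings that fixes ε maps the basic set of h g⁻¹ onto that of f h (f g)⁻¹;
  -- conversely this property alone makes the image partition an S-ring.
  record IsNormalized (_~_ : Rel) {f : Carrier → Carrier} (pf : IsPerm G U L f) : Set where
    open IsPerm pf
    field
      fixes-ε : f ε ≈[ L ] ε
      normal  : ∀ g h → T (U g) → T (U h) → T (inv (f h ∙ f g ⁻¹) ~ (h ∙ g ⁻¹))

  aut-normalized : ∀ {_~_ f} → IsSRing G U L _~_ → (a : IsAut G U L f) → IsNormalized _~_ (proj₁ a)
  aut-normalized S a@(pf , _) = record
    { fixes-ε = aut-ε a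
    ; normal = λ g h ug uh → ≡.subst T (IsSRing.cong S _ _ _ _ (In-// uh ug)
        (inv-In _ (In-// (f-In h uh) (f-In g ug))) (In-// uh ug) (In-// uh ug)
        (≡-trans (≡-sym (left _ (In-// uh ug))) (inv-cong _ _ (f-In _ (In-// uh ug)) (In-// (f-In h uh) (f-In g ug)) (aut-// a h g uh ug))) ≡-refl)
        (IsSRing.refl S _ (In-// uh ug)) }
    where open IsPerm pf

  pushed : ∀ {f} → Rel → IsPerm G U L f → Rel
  pushed _~_ pf x y = IsPerm.inv pf x ~ IsPerm.inv pf y

  module Transport {_~_ : Rel} (S : IsSRing G U L _~_) {f} (pf : IsPerm G U L f) (nf : IsNormalized _~_ pf) where
    open IsPerm pf
    open IsNormalized nf
    module S = IsSRing S

    ~-resp : ∀ {x x' y y'} → T (U x) → T (U x') → T (U y) → T (U y') → x ≈[ L ] x' → y ≈[ L ] y' → T (x ~ y) → T (x' ~ y')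
    ~-resp ux ux' uy uy' h k = ≡.subst T (S.cong _ _ _ _ ux ux' uy uy' h k)

    inv-ε : inv ε ≈[ L ] ε
    inv-ε = ≡-trans (inv-cong _ _ 𝑈.ε-mem (f-In _ 𝑈.ε-mem) (≡-sym fixes-ε)) (left ε 𝑈.ε-mem)

    -- This is `normal` read at preimages: up to basic sets, the inverse respects differences like a
    -- homomorphism, which is what the image partition needs to be an S-ring.
    inv-// : ∀ x y → T (U x) → T (U y) → T (inv (x ∙ y ⁻¹) ~ (inv x ∙ inv y ⁻¹))
    inv-// x y ux uy = ~-resp (inv-In _ (In-// (f-In _ ux') (f-In _ uy'))) (inv-In _ (In-// ux uy)) (In-// ux' uy') (In-// ux' uy')
      (inv-cong _ _ (In-// (f-In _ ux') (f-In _ uy')) (In-// ux uy) (≡-// (right x ux) (right y uy))) ≡-refl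
      (normal (inv y) (inv x) uy' ux')
      where
      ux' = inv-In x ux
      uy' = inv-In y uy

    ~-through : ∀ {x y z} → T (U x) → T (U y) → T (U z) → T (x ~ y) → (T (x ~ z) ⇔ T (y ~ z))
    ~-through ux uy uz h = mk⇔ (S.trans _ _ _ uy ux uz (S.sym _ _ ux uy h)) (S.trans _ _ _ ux uy uz h)

    -- The inverse of f and f itself carry the two solution sets injectively into each other;
    -- `second` uses `inv-//` to pull the inverse inside the product.
    pushed-count : ∀ a b z → T (U a) → T (U b) → T (U z)
      → count G U L (λ x → (inv x ~ inv a) ∧ (inv (x ⁻¹ ∙ z) ~ inv b))
      ≡ count G U L (λ x → (x ~ inv a) ∧ ((x ⁻¹ ∙ inv z) ~ inv b))
    pushed-count a b z ua ub uz = ℕₚ.≤-antisym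
      (count-≤ inv (λ {x} ux t → inv-In x ux , bwd T-∧ (proj₁ (fwd T-∧ t) , fwd (second x ux) (proj₂ (fwd T-∧ t))))
        (inv-injective pf)
        (λ e ux t → let ux' = 𝑈.resp e ux in bwd T-∧
          ( ~-resp ux ux' ua' ua' (of-≈ e) ≡-refl (proj₁ (fwd T-∧ t))
          , ~-resp (In-\\ ux uz') (In-\\ ux' uz') ub' ub' (of-≈ (∙-congʳ (⁻¹-cong e))) ≡-refl (proj₂ (fwd T-∧ t)))))
      (count-≤ f (λ {x} ux t → f-In x ux , bwd T-∧
          ( ~-resp ux (inv-In _ (f-In x ux)) ua' ua' (≡-sym (left x ux)) ≡-refl (proj₁ (fwd T-∧ t))
          , bwd (second (f x) (f-In x ux)) (~-resp (In-\\ ux uz') (In-\\ (inv-In _ (f-In x ux)) uz') ub' ub'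
              (≡-∙ (≡-⁻¹ (≡-sym (left x ux))) ≡-refl) ≡-refl (proj₂ (fwd T-∧ t)))))
        (perm-injective pf)
        (λ {x} {y} e ux t → let ux' = 𝑈.resp e ux in bwd T-∧
          ( ~-resp (inv-In x ux) (inv-In y ux') ua' ua' (inv-cong _ _ ux ux' (of-≈ e)) ≡-refl (proj₁ (fwd T-∧ t))
          , ~-resp (inv-In _ (In-\\ ux uz)) (inv-In _ (In-\\ ux' uz)) ub' ub'
              (inv-cong _ _ (In-\\ ux uz) (In-\\ ux' uz) (of-≈ (∙-congʳ (⁻¹-cong e)))) ≡-refl (proj₂ (fwd T-∧ t)))))
      where
      In-\\ : ∀ {x y} → T (U x) → T (U y) → T (U (x ⁻¹ ∙ y))
      In-\\ ux uy = 𝑈.∙-mem _ _ (𝑈.⁻¹-mem _ ux) uy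
      ua' = inv-In a ua
      ub' = inv-In b ub
      uz' = inv-In z uz
      second : ∀ x → T (U x) → T (inv (x ⁻¹ ∙ z) ~ inv b) ⇔ T ((inv x ⁻¹ ∙ inv z) ~ inv b)
      second x ux = ~-through (inv-In _ (In-\\ ux uz)) (In-\\ (inv-In x ux) uz') ub'
        (~-resp (inv-In _ (In-// uz ux)) (inv-In _ (In-\\ ux uz)) (In-// uz' (inv-In x ux)) (In-\\ (inv-In x ux) uz')
          (inv-cong _ _ (In-// uz ux) (In-\\ ux uz) (of-≈ (comm _ _))) (of-≈ (comm _ _)) (inv-// z x uz ux))

    pushed-SRing : IsSRing G U L (pushed _~_ pf)
    pushed-SRing = record
      { cong = λ x x' y y' ux ux' uy uy' h k → S.cong _ _ _ _ (inv-In x ux) (inv-In x' ux') (inv-In y uy) (inv-In y' uy')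
                 (inv-cong _ _ ux ux' h) (inv-cong _ _ uy uy' k)
      ; refl = λ x ux → S.refl _ (inv-In x ux)
      ; sym = λ x y ux uy → S.sym _ _ (inv-In x ux) (inv-In y uy)
      ; trans = λ x y z ux uy uz → S.trans _ _ _ (inv-In x ux) (inv-In y uy) (inv-In z uz)
      ; identity = λ x ux h → inv-injective pf ux 𝑈.ε-mem (≡-trans
          (S.identity _ (inv-In x ux) (~-resp (inv-In x ux) (inv-In x ux) (inv-In _ 𝑈.ε-mem) 𝑈.ε-mem ≡-refl inv-ε h)) (≡-sym inv-ε))
      ; inverse = λ x y ux uy h → S.trans _ _ _ (inv-In _ (𝑈.⁻¹-mem x ux)) (𝑈.⁻¹-mem _ (inv-In x ux)) (inv-In _ (𝑈.⁻¹-mem y uy)) (inv-⁻¹ x ux)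
          (S.trans _ _ _ (𝑈.⁻¹-mem _ (inv-In x ux)) (𝑈.⁻¹-mem _ (inv-In y uy)) (inv-In _ (𝑈.⁻¹-mem y uy))
            (S.inverse _ _ (inv-In x ux) (inv-In y uy) h)
            (S.sym _ _ (inv-In _ (𝑈.⁻¹-mem y uy)) (𝑈.⁻¹-mem _ (inv-In y uy)) (inv-⁻¹ y uy)))
      ; closed = λ a b z z' ua ub uz uz' h → ≡.trans (pushed-count a b z ua ub uz)
          (≡.trans (S.closed _ _ _ _ (inv-In a ua) (inv-In b ub) (inv-In z uz) (inv-In z' uz') h) (≡.sym (pushed-count a b z' ua ub uz'))) }
      where
      inv-⁻¹ : ∀ x → T (U x) → T (inv (x ⁻¹) ~ (inv x ⁻¹))
      inv-⁻¹ x ux = ~-resp (inv-In _ (In-// 𝑈.ε-mem ux)) (inv-In _ (𝑈.⁻¹-mem x ux)) (In-// (inv-In _ 𝑈.ε-mem) (inv-In x ux)) (𝑈.⁻¹-mem _ (inv-In x ux))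
        (inv-cong _ _ (In-// 𝑈.ε-mem ux) (𝑈.⁻¹-mem x ux) (of-≈ (identityˡ _)))
        (≡-trans (≡-∙ inv-ε ≡-refl) (of-≈ (identityˡ _))) (inv-// ε x 𝑈.ε-mem ux)

    -- The extra factor a lets one proof serve both f alone, with a = id, and the products in Aut(A)
    -- Aut(G).
    pushed-iso : ∀ {a} → AutA G U L _~_ a → IsIsoTo G U L (f ∘ a) _~_ (pushed _~_ pf)
    pushed-iso {a} (pa , auta) =
        (λ c uc → f c , f-In c uc , matches c (f c) uc (f-In c uc) (≡-sym (left c uc)))
      , (λ b ub → inv b , inv-In b ub , matches (inv b) b (inv-In b ub) ub ≡-refl)
      where
      module A = IsPerm pa
      matches : ∀ c b → T (U c) → T (U b) → c ≈[ L ] inv b → ∀ g h → T (U g) → T (U h)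
        → T ((h ∙ g ⁻¹) ~ c) ⇔ T (inv (f (a h) ∙ f (a g) ⁻¹) ~ inv b)
      matches c b uc ub e g h ug uh = mk⇔
        (λ t → ~-resp u₁ u₁ uc (inv-In b ub) ≡-refl e (bwd through (fwd (auta c uc g h ug uh) t)))
        (λ t → bwd (auta c uc g h ug uh) (fwd through (~-resp u₁ u₁ (inv-In b ub) uc ≡-refl (≡-sym e) t)))
        where
        ug' = A.f-In g ug
        uh' = A.f-In h uh
        u₁ = inv-In _ (In-// (f-In _ uh') (f-In _ ug'))
        through = ~-through u₁ (In-// uh' ug') uc (normal (a g) (a h) ug' uh')

  AutA-id : ∀ {_~_} → AutA G U L _~_ id
  AutA-id = id-perm , λ _ _ _ _ _ _ → mk⇔ id id

  AutA-Aut⇒IsoA : ∀ {_~_} → IsSRing G U L _~_ → ∀ a b → AutA G U L _~_ a → IsAut G U L b → IsoA G U L _~_ (b ∘ a)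
  AutA-Aut⇒IsoA S a b auta@(pa , _) autb@(pb , _) = comp-perm pa pb , _ , pushed-SRing , pushed-iso auta
    where open Transport S pb (aut-normalized S autb)

  module CI {_~_ : Rel} (ci : IsCI G U L _~_) (~-refl : ∀ {x} → T (U x) → T (x ~ x))
            (~-respˡ : ∀ {x x' y} → x ≈ x' → T (x ~ y) → T (x' ~ y)) where

    -- id ∈ Aut(A) Aut(G) = Iso(A), so _~_ is an S-ring up to equivalence of relations.
    id∈Iso : IsoA G U L _~_ id
    id∈Iso = proj₂ ci id id (AutA-id {_~_}) id-aut

    _~'_ : Rel
    _~'_ = proj₁ (proj₂ id∈Iso)

    S' : IsSRing G U L _~'_
    S' = proj₁ (proj₂ (proj₂ id∈Iso))

    module S' = IsSRing S'

    -- The identity carries the class of y to the class of some b under `_~'_`. Taking g = ε turns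
    -- this into a statement about single elements, and reflexivity puts y into the class of b.
    ~⇔~' : ∀ {x y} → T (U x) → T (U y) → T (x ~ y) ⇔ T (x ~' y)
    ~⇔~' {x} {y} ux uy with proj₁ (proj₂ (proj₂ (proj₂ id∈Iso))) y uy
    ... | b , ub , m = mk⇔
        (λ t → S'.trans _ _ _ ux ub uy (fwd (through ux) t) (S'.sym _ _ uy ub (fwd (through uy) (~-refl uy))))
        (λ t → bwd (through ux) (S'.trans _ _ _ ux uy ub t (fwd (through uy) (~-refl uy))))
      where
      through : ∀ {x} → T (U x) → T (x ~ y) ⇔ T (x ~' b)
      through {x} ux = mk⇔
        (λ t → ≡.subst T x//ε (fwd (m ε x 𝑈.ε-mem ux) (~-respˡ (sym (//ε x)) t)))
        (λ t → ~-respˡ (//ε x) (bwd (m ε x 𝑈.ε-mem ux) (≡.subst T (≡.sym x//ε) t)))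
        where
        x//ε : ((x // ε) ~' b) ≡ (x ~' b)
        x//ε = S'.cong _ _ _ _ (In-// ux 𝑈.ε-mem) ux ub ub (of-≈ (//ε x)) ≡-refl

    ~-sym : ∀ {x y} → T (U x) → T (U y) → T (x ~ y) → T (y ~ x)
    ~-sym ux uy t = bwd (~⇔~' uy ux) (S'.sym _ _ ux uy (fwd (~⇔~' ux uy) t))

    ~-trans : ∀ {x y z} → T (U x) → T (U y) → T (U z) → T (x ~ y) → T (y ~ z) → T (x ~ z)
    ~-trans ux uy uz s t = bwd (~⇔~' ux uz) (S'.trans _ _ _ ux uy uz (fwd (~⇔~' ux uy) s) (fwd (~⇔~' uy uz) t))

    ≡⇒~ : ∀ {x y} → T (U x) → T (U y) → x ≈[ L ] y → T (x ~ y)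
    ≡⇒~ ux uy h = bwd (~⇔~' ux uy) (≡.subst T (S'.cong _ _ _ _ ux ux ux uy ≡-refl h) (S'.refl _ ux))

    IsIsoTo-~ : ∀ {f _≀_} → IsIsoTo G U L f _~'_ _≀_ → IsIsoTo G U L f _~_ _≀_
    IsIsoTo-~ (m₁ , m₂) =
        (λ c uc → let b , ub , m = m₁ c uc in b , ub , λ g h ug uh → mk⇔
          (λ t → fwd (m g h ug uh) (fwd (~⇔~' (In-// uh ug) uc) t)) (λ t → bwd (~⇔~' (In-// uh ug) uc) (bwd (m g h ug uh) t)))
      , (λ b ub → let c , uc , m = m₂ b ub in c , uc , λ g h ug uh → mk⇔
          (λ t → fwd (m g h ug uh) (fwd (~⇔~' (In-// uh ug) uc) t)) (λ t → bwd (~⇔~' (In-// uh ug) uc) (bwd (m g h ug uh) t)))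

    factor : ∀ {f} (pf : IsPerm G U L f) → IsNormalized _~_ pf
      → ∃[ b ] Σ (IsAut G U L b) λ autb → ∀ x → T (U x) → T (IsPerm.inv (proj₁ autb) (f x) ~ x)
    factor {f} pf nf with proj₁ ci f (pf , _ , Tr.pushed-SRing , IsIsoTo-~ {f} {pushed _~'_ pf} (Tr.pushed-iso (AutA-id {_~'_})))
      where
      open IsPerm pf
      nf' : IsNormalized _~'_ pf
      nf' = record { fixes-ε = IsNormalized.fixes-ε nf
                   ; normal = λ g h ug uh → fwd (~⇔~' (inv-In _ (In-// (f-In h uh) (f-In g ug))) (In-// uh ug)) (IsNormalized.normal nf g h ug uh) }
      module Tr = Transport S' pf nf'
    ... | a , b , (pa , auta) , autb@(pb , _) , f≡ = b , autb , in-class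
      where
      module A = IsPerm pa
      module B = IsPerm pb
      -- Both f and b fix ε, hence so does a. For the pair (ε, x) the condition on a then says that
      -- a x, which is b⁻¹ (f x), lies in the class of x.
      a-ε : a ε ≈[ L ] ε
      a-ε = perm-injective pb (A.f-In ε 𝑈.ε-mem) 𝑈.ε-mem
              (≡-trans (≡-sym (f≡ ε 𝑈.ε-mem)) (≡-trans (IsNormalized.fixes-ε nf) (≡-sym (aut-ε autb))))
      in-class : ∀ x → T (U x) → T (B.inv (f x) ~ x)
      in-class x ux = ~-trans ui (In-// (A.f-In x ux) (A.f-In ε 𝑈.ε-mem)) ux
        (≡⇒~ ui (In-// (A.f-In x ux) (A.f-In ε 𝑈.ε-mem))
          (≡-trans (≡-trans (B.inv-cong _ _ (IsPerm.f-In pf x ux) (B.f-In _ (A.f-In x ux)) (f≡ x ux)) (B.left _ (A.f-In x ux)))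
            (≡-sym (≡-trans (≡-// ≡-refl a-ε) (of-≈ (//ε (a x)))))))
        (fwd (auta x ux ε x 𝑈.ε-mem ux) (~-respˡ (sym (//ε x)) (~-refl ux)))
        where ui = B.inv-In _ (IsPerm.f-In pf x ux)

-- The wreath product: alignment, comparison modulo L, and gluing

module Wreath (G : FiniteGroup) (dp : IsDirProdElemAb G)
  (_~_ : FiniteGroup.Carrier G → FiniteGroup.Carrier G → Bool) (S : IsSRing G (full G) (trivial G) _~_)
  (U L : Subset G) (AU : IsASubgroup G _~_ U) (AL : IsASubgroup G _~_ L) (L⊆U : _⊆_ G L U) where
  open FiniteGroup G
  private
    comm : IsAbelian G
    comm = proj₁ dp
  open AbelianTheory G comm
  open Adjunction G comm
  open Extensions G comm
  open WithExponent (squarefreeExponent dp)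
  open Equivalence using () renaming (to to fwd; from to bwd)

  Us : IsSubgroup G U
  Us = proj₁ AU

  Ls : IsSubgroup G L
  Ls = proj₁ AL

  module 𝑈 = Cosets Us
  module 𝐿 = Cosets Ls
  module OnG = Section G comm full-subgroup trivial-subgroup (λ _ _ → tt)
  module OnU = Section G comm Us trivial-subgroup (trivial⊆ Us)
  module OnG/L = Section G comm full-subgroup Ls (λ _ _ → tt)
  module OnU/L = Section G comm Us Ls L⊆U

  ~-refl : ∀ {x} → T (x ~ x)
  ~-refl = IsSRing.refl S _ tt

  ~-sym : ∀ {x y} → T (x ~ y) → T (y ~ x)
  ~-sym = IsSRing.sym S _ _ tt tt

  ~-trans : ∀ {x y z} → T (x ~ y) → T (y ~ z) → T (x ~ z)
  ~-trans = IsSRing.trans S _ _ _ tt tt tt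

  ~-resp : ∀ {x x' y y'} → x ≈ x' → y ≈ y' → T (x ~ y) → T (x' ~ y')
  ~-resp e e' = ≡.subst T (IsSRing.cong S _ _ _ _ tt tt tt tt (≈⇒≡trivial e) (≈⇒≡trivial e'))

  quot-intro : ∀ {K} → IsSubgroup G K → ∀ {x y a b} → x ≈[ K ] a → y ≈[ K ] b → T (a ~ b) → T (quot G K _~_ x y)
  quot-intro Ks {x} {y} {a} {b} xa yb ab = any⁺ _ (Any.map (λ {a'} e → any⁺ _ (Any.map (λ {b'} e' →
      bwd T-∧ (∈-resp Ks (∙-congˡ e) xa , bwd T-∧ (∈-resp Ks (∙-congˡ e') yb , ~-resp e e' ab))) (complete b))) (complete a))

  quot-elim : ∀ K x y → T (quot G K _~_ x y) → ∃[ a ] ∃[ b ] x ≈[ K ] a × y ≈[ K ] b × T (a ~ b)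
  quot-elim K x y t with Any.satisfied (any⁻ _ elems t)
  ... | a , t' with Any.satisfied (any⁻ _ elems t')
  ...   | b , t'' =
          let xa , rest = fwd (T-∧ {K (x ⁻¹ ∙ a)}) t''
              yb , ab = fwd (T-∧ {K (y ⁻¹ ∙ b)}) rest
          in a , b , xa , yb , ab

  quot-⊇ : ∀ {K} → IsSubgroup G K → ∀ {x y} → T (x ~ y) → T (quot G K _~_ x y)
  quot-⊇ Ks = quot-intro Ks (Cosets.≡-refl Ks) (Cosets.≡-refl Ks)

  quot-trivial-⊆ : ∀ {x y} → T (quot G (trivial G) _~_ x y) → T (x ~ y)
  quot-trivial-⊆ {x} {y} t with quot-elim (trivial G) x y t
  ... | a , b , xa , yb , ab = ~-resp (sym (≡trivial⇒≈ xa)) (sym (≡trivial⇒≈ yb)) ab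

  quot-respˡ : ∀ {K} → IsSubgroup G K → ∀ {x x' y} → x ≈ x' → T (quot G K _~_ x y) → T (quot G K _~_ x' y)
  quot-respˡ {K} Ks {x} {_} {y} e t with quot-elim K x y t
  ... | a , b , xa , yb , ab = quot-intro Ks (∈-resp Ks (∙-congʳ (⁻¹-cong e)) xa) yb ab

  U-closed : ∀ {x y} → T (x ~ y) → T (U x) → T (U y)
  U-closed {x} {y} h = ≡.subst T (proj₂ AU x y h)

  L-closed : ∀ {x y} → T (x ~ y) → T (L x) → T (L y)
  L-closed {x} {y} h = ≡.subst T (proj₂ AL x y h)

  U-quot-closed : ∀ {x y} → T (quot G L _~_ x y) → T (U y) → T (U x)
  U-quot-closed {x} {y} t uy with quot-elim L x y t
  ... | a , b , xa , yb , ab = OnU/L.In-≡ (𝐿.≡-sym xa) (U-closed (~-sym ab) (OnU/L.In-≡ yb uy))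

  -- The target S-ring is forgotten: its basic sets are the images of those of `_~_`, and `normal`
  -- retains what is needed about them.
  record NormalizedIso (f : Carrier → Carrier) : Set where
    field
      inv      : Carrier → Carrier
      f-cong   : ∀ {x y} → x ≈ y → f x ≈ f y
      inv-cong : ∀ {x y} → x ≈ y → inv x ≈ inv y
      left     : ∀ x → inv (f x) ≈ x
      right    : ∀ x → f (inv x) ≈ x
      fixes-ε  : f ε ≈ ε
      normal   : ∀ g h → T (inv (f h // f g) ~ (h // g))

    inv-ε : inv ε ≈ ε
    inv-ε = trans (inv-cong (sym fixes-ε)) (left ε)

    image : Subset G → Subset G
    image K y = K (inv y)

    -- By `normal`, the preimage of x // y lies in the basic set of a difference of elements of K,
    -- and K is a union of basic sets. Products are then obtained as x // y ⁻¹.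
    image-subgroup : ∀ {K} → IsSubgroup G K → (∀ {x y} → T (x ~ y) → T (K x) → T (K y)) → IsSubgroup G (image K)
    image-subgroup {K} Ks closed = record
      { resp = λ e → IsSubgroup.resp Ks (inv-cong e)
      ; ε∈ = ε∈'
      ; ∙∈ = λ x y kx ky → resp (inv-cong (∙-congˡ (⁻¹-involutive y))) (//∈ x (y ⁻¹) kx (⁻¹∈' y ky))
      ; ⁻¹∈ = ⁻¹∈' }
      where
      open Cosets Ks
      ε∈' : T (K (inv ε))
      ε∈' = resp (sym inv-ε) ε-mem
      //∈ : ∀ x y → T (K (inv x)) → T (K (inv y)) → T (K (inv (x // y)))
      //∈ x y kx ky = resp (inv-cong (//-cong₂ (right x) (right y)))
        (closed (~-sym (normal (inv y) (inv x))) (//-mem _ _ kx ky))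
      ⁻¹∈' : ∀ y → T (K (inv y)) → T (K (inv (y ⁻¹)))
      ⁻¹∈' y ky = resp (inv-cong (identityˡ _)) (//∈ ε y ε∈' ky)

    enum-image : ∀ {K n} → IsSubgroup G K → Enum K n → Enum (image K) n
    enum-image Ks = enum-bijection {f = f} {g = inv} (λ {x} → ∈-resp Ks (sym (left x))) id
      (λ {x} {y} _ _ e → trans (sym (left x)) (trans (inv-cong e) (left y))) (λ _ _ → f-cong) (λ {x} _ → right x)

  normalize : ∀ {f} → IsoA G (full G) (trivial G) _~_ f → NormalizedIso (λ x → f x // f ε)
  normalize {f} (pf , _~'_ , S' , m , _) = record
    { inv = λ y → inv (y ∙ f ε)
    ; f-cong = λ e → ∙-congʳ (f-cong' e)
    ; inv-cong = λ e → ≡trivial⇒≈ (inv-cong _ _ tt tt (≈⇒≡trivial (∙-congʳ e)))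
    ; left = λ x → trans (≡trivial⇒≈ (inv-cong _ _ tt tt (≈⇒≡trivial (//-rightDividesˡ (f ε) (f x))))) (≡trivial⇒≈ (left x tt))
    ; right = λ y → trans (∙-congʳ (≡trivial⇒≈ (right _ tt))) (//-rightDividesʳ (f ε) y)
    ; fixes-ε = inverseʳ (f ε)
    ; normal = normal }
    where
    open IsPerm pf
    f-cong' : ∀ {x y} → x ≈ y → f x ≈ f y
    f-cong' e = ≡trivial⇒≈ (f-cong _ _ tt tt (≈⇒≡trivial e))
    normal : ∀ g h → T (inv (((f h // f ε) // (f g // f ε)) ∙ f ε) ~ (h // g))
    -- The element y is chosen so that f y // f ε equals f h // f g; the pairs (ε, y) and (g, h)
    -- then lie in the same basic relation.
    normal g h with m (h // g) tt
    ... | b , _ , eqv = ~-resp (//ε y) refl (bwd (eqv ε y tt tt)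
        (≡.subst T (IsSRing.cong S' _ _ _ _ tt tt tt tt (≈⇒≡trivial fh//fg) (≈⇒≡trivial refl)) (fwd (eqv g h tt tt) ~-refl)))
      where
      y = inv (((f h // f ε) // (f g // f ε)) ∙ f ε)
      fh//fg : f h // f g ≈ f y // f ε
      fh//fg = trans (sym (//-cancelʳ (f h) (f g) (f ε))) (trans (sym (//-rightDividesʳ (f ε) _)) (∙-congʳ (sym (≡trivial⇒≈ (right _ tt)))))

  compose : ∀ {f} → NormalizedIso f → (π : PartialIso (full G) (full G)) → NormalizedIso (PartialIso.to π ∘ f)
  compose {f} nf π = record
    { inv = F.inv ∘ from
    ; f-cong = λ e → to-cong (F.f-cong e)
    ; inv-cong = λ e → F.inv-cong (from-cong e)
    ; left = λ x → trans (F.inv-cong (from-to tt)) (F.left x)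
    ; right = λ y → trans (to-cong (F.right _)) (to-from tt)
    ; fixes-ε = trans (to-cong F.fixes-ε) (hom-ε full-subgroup to-hom)
    ; normal = λ g h → ~-resp (F.inv-cong (sym (trans (hom-// full-subgroup from-hom {to (f h)} {to (f g)} tt tt)
        (//-cong₂ (from-to tt) (from-to tt))))) refl (F.normal g h) }
    where
    open PartialIso π
    module F = NormalizedIso nf
    to-cong : ∀ {x y} → x ≈ y → to x ≈ to y
    to-cong = IsHomOn.cong-on to-hom tt tt
    from-cong : ∀ {x y} → x ≈ y → from x ≈ from y
    from-cong = IsHomOn.cong-on from-hom tt tt

  record Preserves {f : Carrier → Carrier} (nf : NormalizedIso f) (K : Subset G) : Set where
    field
      f∈   : ∀ {x} → T (K x) → T (K (f x))
      inv∈ : ∀ {x} → T (K x) → T (K (NormalizedIso.inv nf x))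

  -- Since U and its image have equal orders, and likewise L, some automorphism of G carries the images back.
  align : ∀ {f} (nf : NormalizedIso f) → Σ (PartialIso (full G) (full G)) λ π →
    Preserves (compose nf π) U × Preserves (compose nf π) L
  align {f} nf =
    let _ , eL = enumerate Ls
        _ , eU = enumerate Us
        _ , eG = enumerate full-subgroup
        -- The flag L ≤ U ≤ G is handled from the bottom, so that each isomorphism extends the
        -- previous one and the last respects both subgroups.
        π₁ , _ , _ = extend-iso trivial-subgroup trivial-subgroup L's Ls (trivial⊆ L's) (trivial⊆ Ls) (enum-image Ls eL) eL id-iso
        π₂ , to₂ , from₂ = extend-iso L's Ls U's Us (λ x → L⊆U (inv x)) L⊆U (enum-image Us eU) eU π₁
        π₃ , to₃ , from₃ = extend-iso U's Us full-subgroup full-subgroup (λ _ _ → tt) (λ _ _ → tt) eG eG π₂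
    in π₃
     , record
       { f∈ = λ {x} ux → let fx∈ = 𝑈.resp (sym (left x)) ux in 𝑈.resp (sym (to₃ fx∈)) (PartialIso.to∈ π₂ fx∈)
       ; inv∈ = λ ux → 𝑈.resp (inv-cong (sym (from₃ ux))) (PartialIso.from∈ π₂ ux) }
     , record
       { f∈ = λ {x} lx → let fx∈ = 𝐿.resp (sym (left x)) lx in
           𝐿.resp (sym (trans (to₃ (L⊆U _ fx∈)) (to₂ fx∈))) (PartialIso.to∈ π₁ fx∈)
       ; inv∈ = λ lx → 𝐿.resp (inv-cong (sym (trans (from₃ (L⊆U _ lx)) (from₂ lx)))) (PartialIso.from∈ π₁ lx) }
    where
    open NormalizedIso nf
    L's = image-subgroup Ls L-closed
    U's = image-subgroup Us U-closed

  -- The common form of the three hypotheses: in the two special cases g or f is the identity.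
  AutSCovered : Set
  AutSCovered = ∀ σ → AutGA G U L (quot G L _~_) σ → ∃[ f ] ∃[ g ]
      (InAutUS G _~_ U L f × InAutGLS G _~_ U L g × (∀ x → T (U x) → σ x ≈[ L ] g (f x)))

  module Aligned (wreath : IsWreath G _~_ U L)
    (ciU : IsCI G U (trivial G) (quot G (trivial G) _~_)) (ciGL : IsCI G (full G) L (quot G L _~_))
    (cover : AutSCovered)
    {f : Carrier → Carrier} (nf : NormalizedIso f) (f-U : Preserves nf U) (f-L : Preserves nf L) where
    open NormalizedIso nf
    module CU = OnU.CI {quot G (trivial G) _~_} ciU (λ _ → quot-⊇ trivial-subgroup ~-refl) (quot-respˡ trivial-subgroup)
    module CQ = OnG/L.CI {quot G L _~_} ciGL (λ _ → quot-⊇ Ls ~-refl) (quot-respˡ Ls)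
    module fU = Preserves f-U
    module fL = Preserves f-L

    f-U-perm : IsPerm G U (trivial G) f
    f-U-perm = record
      { inv = inv ; f-In = λ _ → fU.f∈ ; inv-In = λ _ → fU.inv∈
      ; f-cong = λ _ _ _ _ e → ≈⇒≡trivial (f-cong (≡trivial⇒≈ e))
      ; inv-cong = λ _ _ _ _ e → ≈⇒≡trivial (inv-cong (≡trivial⇒≈ e))
      ; left = λ x _ → ≈⇒≡trivial (left x) ; right = λ x _ → ≈⇒≡trivial (right x) }

    -- For congruent x and y, the preimage of f y // f x lies in the basic set of y // x, hence in
    -- L; since f preserves L, the images are congruent too.
    f-G/L-perm : IsPerm G (full G) L f
    f-G/L-perm = record
      { inv = inv ; f-In = λ _ _ → tt ; inv-In = λ _ _ → tt
      ; f-cong = λ x y _ _ h → 𝐿.resp (trans (right _) (sym (\\≈// (f x) (f y))))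
          (fL.f∈ (L-closed (~-sym (normal x y)) (𝐿.resp (\\≈// x y) h)))
      ; inv-cong = λ x y _ _ h → 𝐿.resp (sym (\\≈// _ _)) (L-closed (normal (inv x) (inv y))
          (fL.inv∈ (𝐿.resp (trans (\\≈// x y) (//-cong₂ (sym (right y)) (sym (right x)))) h)))
      ; left = λ x _ → 𝐿.of-≈ (left x) ; right = λ x _ → 𝐿.of-≈ (right x) }

    opaque
      factor-U : ∃[ b ] Σ (IsAut G U (trivial G) b) λ autb → ∀ x → T (U x) → T (quot G (trivial G) _~_ (IsPerm.inv (proj₁ autb) (f x)) x)
      factor-U = CU.factor f-U-perm (record { fixes-ε = ≈⇒≡trivial fixes-ε ; normal = λ g h _ _ → quot-⊇ trivial-subgroup (normal g h) })

      factor-G/L : ∃[ b ] Σ (IsAut G (full G) L b) λ autb → ∀ x → T (full G x) → T (quot G L _~_ (IsPerm.inv (proj₁ autb) (f x)) x)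
      factor-G/L = CQ.factor f-G/L-perm (record { fixes-ε = 𝐿.of-≈ fixes-ε ; normal = λ g h _ _ → quot-⊇ Ls (normal g h) })

    φ₁ φ₂ : Carrier → Carrier
    φ₁ = proj₁ factor-U
    φ₂ = proj₁ factor-G/L

    aut₁ : IsAut G U (trivial G) φ₁
    aut₁ = proj₁ (proj₂ factor-U)

    aut₂ : IsAut G (full G) L φ₂
    aut₂ = proj₁ (proj₂ factor-G/L)

    module Φ₁ = IsPerm (proj₁ aut₁)
    module Φ₂ = IsPerm (proj₁ aut₂)

    φ₁-class : ∀ {x} → T (U x) → T (Φ₁.inv (f x) ~ x)
    φ₁-class ux = quot-trivial-⊆ (proj₂ (proj₂ factor-U) _ ux)

    φ₂-class : ∀ x → T (quot G L _~_ (Φ₂.inv (f x)) x)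
    φ₂-class x = proj₂ (proj₂ factor-G/L) x tt

    φ₁-inv-cong : ∀ {x y} → T (U x) → T (U y) → x ≈ y → Φ₁.inv x ≈ Φ₁.inv y
    φ₁-inv-cong ux uy e = ≡trivial⇒≈ (Φ₁.inv-cong _ _ ux uy (≈⇒≡trivial e))

    φ₁-class' : ∀ {x} → T (U x) → T (x ~ inv (φ₁ x))
    φ₁-class' {x} ux = ~-resp (trans (φ₁-inv-cong (fU.f∈ z∈) φx∈ (right (φ₁ x))) (≡trivial⇒≈ (Φ₁.left x ux))) refl (φ₁-class z∈)
      where
      φx∈ = Φ₁.f-In x ux
      z∈ = fU.inv∈ φx∈

    -- φ₁ x is the image under f of an element of the basic set of x; that element lies in L, and f
    -- preserves L. This is what lets φ₁ act on U/L.
    φ₁-L : ∀ {x} → T (L x) → T (L (φ₁ x))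
    φ₁-L lx = 𝐿.resp (right _) (fL.f∈ (L-closed (φ₁-class' (L⊆U _ lx)) lx))

    φ₁-inv-L : ∀ {x} → T (L x) → T (L (Φ₁.inv x))
    φ₁-inv-L {x} lx = L-closed (~-sym (~-resp (φ₁-inv-cong (fU.f∈ (L⊆U _ z∈)) (L⊆U _ lx) (right x)) refl (φ₁-class (L⊆U _ z∈)))) z∈
      where z∈ = fL.inv∈ lx

    φ₂-inv-U : ∀ {x} → T (U x) → T (U (Φ₂.inv x))
    φ₂-inv-U {x} ux = OnU/L.In-≡ (Φ₂.inv-cong _ _ tt tt (𝐿.of-≈ (right x))) (U-quot-closed (φ₂-class (inv x)) (fU.inv∈ ux))

    φ₂-U : ∀ {x} → T (U x) → T (U (φ₂ x))
    φ₂-U {x} ux = 𝑈.resp (right _) (fU.f∈ (U-quot-closed (CQ.~-sym tt tt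
      (φ₂-class (inv (φ₂ x)))) (OnU/L.In-≡ (𝐿.≡-sym (𝐿.≡-trans (Φ₂.inv-cong _ _ tt tt (𝐿.of-≈ (right _))) (Φ₂.left x tt))) ux)))

    aut₁-mod-L : ∀ {b} (autb : IsAut G U (trivial G) b) → (∀ {x} → T (L x) → T (L (b x))) → ∀ x y → T (U x) → T (U y)
      → x ≈[ L ] y → b x ≈[ L ] b y
    aut₁-mod-L autb b-L x y ux uy h = 𝐿.resp
      (trans (≡trivial⇒≈ (IsPerm.f-cong (proj₁ autb) _ _ (L⊆U _ h) (𝑈.//-mem _ _ uy ux) (≈⇒≡trivial (\\≈// x y))))
        (trans (≡trivial⇒≈ (OnU.aut-// autb y x uy ux)) (sym (\\≈// _ _)))) (b-L h)

    aut₁/L : IsAut G U L φ₁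
    aut₁/L = record
      { inv = Φ₁.inv ; f-In = Φ₁.f-In ; inv-In = Φ₁.inv-In
      ; f-cong = aut₁-mod-L aut₁ φ₁-L
      ; inv-cong = aut₁-mod-L (OnU.inv-aut aut₁) φ₁-inv-L
      ; left = λ x ux → 𝐿.of-≈ (≡trivial⇒≈ (Φ₁.left x ux)) ; right = λ x ux → 𝐿.of-≈ (≡trivial⇒≈ (Φ₁.right x ux)) }
      , λ x y ux uy → 𝐿.of-≈ (≡trivial⇒≈ (proj₂ aut₁ x y ux uy))

    aut₂/L : IsAut G U L φ₂
    aut₂/L = record
      { inv = Φ₂.inv ; f-In = λ _ → φ₂-U ; inv-In = λ _ → φ₂-inv-U
      ; f-cong = λ _ _ _ _ → Φ₂.f-cong _ _ tt tt ; inv-cong = λ _ _ _ _ → Φ₂.inv-cong _ _ tt tt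
      ; left = λ x _ → Φ₂.left x tt ; right = λ x _ → Φ₂.right x tt }
      , λ x y _ _ → proj₂ aut₂ x y tt tt

    σ : Carrier → Carrier
    σ x = Φ₂.inv (φ₁ x)

    -- f cancels: with z = f⁻¹ (φ₁ x), σ x is φ₂⁻¹ (f z) modulo L, which is in the class of z, and z
    -- is in the class of x.
    σ-class : ∀ {x} → T (U x) → T (quot G L _~_ (σ x) x)
    σ-class {x} ux = CQ.~-trans tt tt tt (CQ.≡⇒~ tt tt (Φ₂.inv-cong _ _ tt tt (𝐿.of-≈ (sym (right (φ₁ x))))))
      (CQ.~-trans tt tt tt (φ₂-class (inv (φ₁ x))) (quot-⊇ Ls (~-sym (φ₁-class' ux))))

    σ∈Aut : AutGA G U L (quot G L _~_) σ
    σ∈Aut = OnU/L.comp-aut aut₁/L (OnU/L.inv-aut aut₂/L) , λ a x _ ux → mk⇔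
      (CQ.~-trans tt tt tt (σ-class ux)) (CQ.~-trans tt tt tt (CQ.~-sym tt tt (σ-class ux)))

    opaque
      σ-split : ∃[ u ] ∃[ v ] (InAutUS G _~_ U L u × InAutGLS G _~_ U L v × (∀ x → T (U x) → σ x ≈[ L ] v (u x)))
      σ-split = cover σ σ∈Aut

    u v : Carrier → Carrier
    u = proj₁ σ-split
    v = proj₁ (proj₂ σ-split)

    u∈ : AutGA G U (trivial G) (quot G (trivial G) _~_) u
    u∈ = proj₁ (proj₁ (proj₂ (proj₂ σ-split)))

    v∈ : AutGA G (full G) L (quot G L _~_) v
    v∈ = proj₁ (proj₁ (proj₂ (proj₂ (proj₂ σ-split))))

    σ≡ : ∀ x → T (U x) → σ x ≈[ L ] v (u x)
    σ≡ = proj₂ (proj₂ (proj₂ (proj₂ σ-split)))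

    module 𝑢 = IsPerm (proj₁ (proj₁ u∈))
    module 𝑣 = IsPerm (proj₁ (proj₁ v∈))

    u-class : ∀ {x} → T (U x) → T (u x ~ x)
    u-class ux = quot-trivial-⊆ (fwd (proj₂ u∈ _ _ ux ux) (quot-⊇ trivial-subgroup ~-refl))

    v-inv-class : ∀ x → T (quot G L _~_ (𝑣.inv x) x)
    v-inv-class x = CQ.~-sym tt tt (CQ.~-trans tt tt tt (CQ.≡⇒~ tt tt (𝐿.≡-sym (𝑣.right x tt)))
      (fwd (proj₂ v∈ (𝑣.inv x) (𝑣.inv x) tt tt) (quot-⊇ Ls ~-refl)))

    -- σ = v ∘ u on U/L makes these two agree there.
    ψ₁ ψ₂ : Carrier → Carrier
    ψ₁ x = φ₁ (𝑢.inv x)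
    ψ₂ x = φ₂ (v x)

    autψ₁ : IsAut G U (trivial G) ψ₁
    autψ₁ = OnU.comp-aut (OnU.inv-aut (proj₁ u∈)) aut₁

    autψ₂ : IsAut G (full G) L ψ₂
    autψ₂ = OnG/L.comp-aut (proj₁ v∈) aut₂

    module Ψ₁ = IsPerm (proj₁ autψ₁)
    module Ψ₂ = IsPerm (proj₁ autψ₂)

    agree : ∀ {x} → T (U x) → ψ₁ x ≈[ L ] ψ₂ x
    agree {x} ux = 𝐿.≡-trans (𝐿.≡-sym (Φ₂.right _ tt)) (Φ₂.f-cong _ _ tt tt
      (𝐿.≡-trans (σ≡ _ (𝑢.inv-In x ux)) (𝑣.f-cong _ _ tt tt (𝐿.of-≈ (≡trivial⇒≈ (𝑢.right x ux))))))

    opaque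
      glued : ∃[ ψ ] IsHomOn (full G) ψ × (∀ {x} → T (U x) → ψ x ≈ ψ₁ x) × (∀ x → ψ x ≈[ L ] ψ₂ x)
      glued = glue Us Ls
        (record { cong-on = λ ux uy e → ≡trivial⇒≈ (Ψ₁.f-cong _ _ ux uy (≈⇒≡trivial e))
                ; homo-on = λ ux uy → ≡trivial⇒≈ (proj₂ autψ₁ _ _ ux uy) })
        (Ψ₂.f-cong _ _ tt tt) (λ x y → proj₂ autψ₂ x y tt tt) agree

    ψ : Carrier → Carrier
    ψ = proj₁ glued

    ψ-hom : IsHomOn (full G) ψ
    ψ-hom = proj₁ (proj₂ glued)

    ψ≈ψ₁ : ∀ {x} → T (U x) → ψ x ≈ ψ₁ x
    ψ≈ψ₁ = proj₁ (proj₂ (proj₂ glued))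

    ψ≡ψ₂ : ∀ x → ψ x ≈[ L ] ψ₂ x
    ψ≡ψ₂ = proj₂ (proj₂ (proj₂ glued))

    ψ-∙ : ∀ x y → ψ (x ∙ y) ≈ ψ x ∙ ψ y
    ψ-∙ x y = IsHomOn.homo-on ψ-hom tt tt

    -- Invert modulo L first, then correct by the inverse on U.
    ψ⁻¹ : Carrier → Carrier
    ψ⁻¹ y = Ψ₂.inv y ∙ Ψ₁.inv (ψ (Ψ₂.inv y) \\ y)

    ψ-ψ₁-inv : ∀ {x} → T (U x) → ψ (Ψ₁.inv x) ≈ x
    ψ-ψ₁-inv {x} ux = trans (ψ≈ψ₁ (Ψ₁.inv-In x ux)) (≡trivial⇒≈ (Ψ₁.right x ux))

    ψ-ψ⁻¹ : ∀ y → ψ (ψ⁻¹ y) ≈ y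
    ψ-ψ⁻¹ y = trans (ψ-∙ _ _) (trans (∙-congˡ (ψ-ψ₁-inv (L⊆U _ (𝐿.≡-trans (ψ≡ψ₂ _) (Ψ₂.right y tt))))) (\\-leftDividesˡ _ y))

    -- Injectivity of ψ₂ modulo L puts d into L, hence into U, where ψ is the injective ψ₁.
    ψ-kernel : ∀ {d} → ψ d ≈ ε → d ≈ ε
    ψ-kernel {d} e = ≡trivial⇒≈ (OnU.perm-injective (proj₁ autψ₁) ud 𝑈.ε-mem
      (≈⇒≡trivial (trans (sym (ψ≈ψ₁ ud)) (trans e (sym (≡trivial⇒≈ (OnU.aut-ε autψ₁)))))))
      where
      d≡ε : d ≈[ L ] ε
      d≡ε = OnG/L.perm-injective (proj₁ autψ₂) tt tt
        (𝐿.≡-trans (𝐿.≡-sym (ψ≡ψ₂ d)) (𝐿.≡-trans (𝐿.of-≈ e) (𝐿.≡-sym (OnG/L.aut-ε autψ₂))))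
      ud : T (U d)
      ud = L⊆U _ (𝐿.ε≡⇒mem (𝐿.≡-sym d≡ε))

    ψ-injective : ∀ {x y} → ψ x ≈ ψ y → x ≈ y
    ψ-injective {x} {y} e = x∙y⁻¹≈ε⇒x≈y x y (ψ-kernel
      (trans (hom-// full-subgroup ψ-hom {x} {y} tt tt) (x≈y⇒x∙y⁻¹≈ε e)))

    ψ-iso : PartialIso (full G) (full G)
    ψ-iso = record
      { to = ψ ; from = ψ⁻¹ ; to-hom = ψ-hom
      ; from-hom = record
        { cong-on = λ {x} {y} _ _ e → ψ-injective (trans (ψ-ψ⁻¹ x) (trans e (sym (ψ-ψ⁻¹ y))))
        ; homo-on = λ {x} {y} _ _ → ψ-injective (trans (ψ-ψ⁻¹ _) (sym (trans (ψ-∙ _ _) (∙-cong (ψ-ψ⁻¹ x) (ψ-ψ⁻¹ y))))) }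
      ; to∈ = λ _ → tt ; from∈ = λ _ → tt
      ; from-to = λ _ → ψ-injective (ψ-ψ⁻¹ _)
      ; to-from = λ _ → ψ-ψ⁻¹ _ }

    -- On U the map ψ⁻¹ f is u φ₁⁻¹ f, and both u and φ₁⁻¹ f keep each element in its basic set.
    class-on-U : ∀ {x} → T (U x) → T (ψ⁻¹ (f x) ~ x)
    class-on-U {x} ux = ~-resp (ψ-injective (trans (ψ-ψ₁-inv (fU.f∈ ux)) (sym (ψ-ψ⁻¹ (f x))))) refl
      (~-trans (u-class (Φ₁.inv-In _ (fU.f∈ ux))) (φ₁-class ux))

    class-mod-L : ∀ x → T (quot G L _~_ (ψ⁻¹ (f x)) x)
    class-mod-L x = CQ.~-trans tt tt tt (CQ.≡⇒~ tt tt w≡) (CQ.~-trans tt tt tt (v-inv-class _) (φ₂-class x))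
      where
      w≡ : ψ⁻¹ (f x) ≈[ L ] Ψ₂.inv (f x)
      w≡ = OnG/L.perm-injective (proj₁ autψ₂) tt tt
        (𝐿.≡-trans (𝐿.≡-sym (ψ≡ψ₂ _)) (𝐿.≡-trans (𝐿.of-≈ (ψ-ψ⁻¹ (f x))) (𝐿.≡-sym (Ψ₂.right (f x) tt))))

    -- The related representatives a and b lie outside U, since L ≤ U, so their basic set is a union
    -- of L-cosets and also contains y and x.
    class-off-U : ∀ {x y} → ¬ T (U x) → T (quot G L _~_ y x) → T (y ~ x)
    class-off-U {x} {y} x∉ t with quot-elim L y x t
    ... | a , b , ya , xb , ab = ~-trans (shift (𝐿.≡-sym ya) ab) (~-sym (shift (𝐿.≡-sym xb) ~-refl))
      where
      b∉ : ¬ T (U b)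
      b∉ ub = x∉ (OnU/L.In-≡ (𝐿.≡-sym xb) ub)
      shift : ∀ {c d} → c ≈[ L ] d → T (c ~ b) → T (d ~ b)
      shift {c} {d} h cb = ~-resp (trans (comm _ _) (\\-leftDividesˡ c d)) refl
        (fwd (proj₁ (proj₂ wreath b (λ all → b∉ (all b ~-refl)) (c \\ d) h c)) cb)

    class-preserved : ∀ x → T (ψ⁻¹ (f x) ~ x)
    class-preserved x with T? (U x)
    ... | yes ux = class-on-U ux
    ... | no x∉ = class-off-U x∉ (class-mod-L x)

  -- Factorization of the original isomorphism

  iso⇒aut : (π : PartialIso (full G) (full G)) → IsAut G (full G) (trivial G) (PartialIso.to π)
  iso⇒aut π = record
    { inv = from ; f-In = λ _ _ → tt ; inv-In = λ _ _ → tt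
    ; f-cong = λ _ _ _ _ e → ≈⇒≡trivial (IsHomOn.cong-on to-hom tt tt (≡trivial⇒≈ e))
    ; inv-cong = λ _ _ _ _ e → ≈⇒≡trivial (IsHomOn.cong-on from-hom tt tt (≡trivial⇒≈ e))
    ; left = λ _ _ → ≈⇒≡trivial (from-to tt) ; right = λ _ _ → ≈⇒≡trivial (to-from tt) }
    , λ _ _ _ _ → ≈⇒≡trivial (IsHomOn.homo-on to-hom tt tt)
    where open PartialIso π

  Factorization : (Carrier → Carrier) → Set
  Factorization f = ∃[ a ] ∃[ b ]
    (AutA G (full G) (trivial G) _~_ a × IsAut G (full G) (trivial G) b × (∀ x → T (full G x) → f x ≈[ trivial G ] b (a x)))

  -- ρ stands for ψ. The factor a is b⁻¹ f with the original f: the translation by f ε is absorbed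
  -- by a, since Aut(A) contains translations, while b has to be a group automorphism.
  module _ {f : Carrier → Carrier} (pf : IsPerm G (full G) (trivial G) f) (π ρ : PartialIso (full G) (full G))
           (nf : NormalizedIso (λ x → PartialIso.to π (f x // f ε)))
           (class-preserved : ∀ x → T (PartialIso.from ρ (PartialIso.to π (f x // f ε)) ~ x)) where
    private
      module Π = PartialIso π
      module Ρ = PartialIso ρ
      open NormalizedIso nf

      f₁ a b : Carrier → Carrier
      f₁ x = Π.to (f x // f ε)
      a x = Ρ.from (Π.to (f x))
      b x = Π.from (Ρ.to x)

      autb : IsAut G (full G) (trivial G) b
      autb = OnG.comp-aut (iso⇒aut ρ) (iso⇒aut (swap π))

      from-cong : ∀ {x y} → x ≈ y → Ρ.from x ≈ Ρ.from y
      from-cong = IsHomOn.cong-on Ρ.from-hom tt tt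

      to-// : ∀ x y → Π.to (x // y) ≈ Π.to x // Π.to y
      to-// x y = hom-// full-subgroup Π.to-hom {x} {y} tt tt

      difference : ∀ g h → Ρ.from (f₁ h // f₁ g) ≈ a h // a g
      difference g h = trans
        (from-cong (trans (sym (to-// (f h // f ε) (f g // f ε)))
          (trans (IsHomOn.cong-on Π.to-hom tt tt (//-cancelʳ (f h) (f g) (f ε))) (to-// (f h) (f g)))))
        (hom-// full-subgroup Ρ.from-hom {Π.to (f h)} {Π.to (f g)} tt tt)

      -- Aut(A) is a condition on differences. With z = inv (f₁ h // f₁ g), the difference a h // a
      -- g is `Ρ.from` (f₁ z), which is in the class of z by `class-preserved`; z is in that of h //
      -- g by `normal`.
      a-class : ∀ g h → T ((a h // a g) ~ (h // g))
      a-class g h = ~-trans (~-resp (trans (from-cong (right _)) (difference g h)) refl (class-preserved (inv (f₁ h // f₁ g)))) (normal g h)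

    factorization : Factorization f
    factorization = a , b
      , (OnG.comp-perm pf (OnG.inv-perm (proj₁ autb)) , λ c _ g h _ _ → mk⇔ (~-trans (a-class g h)) (~-trans (~-sym (a-class g h))))
      , autb
      , λ x _ → ≈⇒≡trivial (sym (≡trivial⇒≈ (IsPerm.right (proj₁ autb) (f x) tt)))

  CI-of-cover : IsWreath G _~_ U L
    → IsCI G U (trivial G) (quot G (trivial G) _~_) → IsCI G (full G) L (quot G L _~_)
    → AutSCovered
    → IsCI G (full G) (trivial G) _~_
  CI-of-cover wreath ciU ciGL cover = (λ f iso → factorize iso (normalize iso)) , OnG.AutA-Aut⇒IsoA S
    where
    factorize : ∀ {f} → IsoA G (full G) (trivial G) _~_ f → NormalizedIso (λ x → f x // f ε) → Factorization f
    factorize (pf , _) nf =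
      let π , π-U , π-L = align nf
          module A = Aligned wreath ciU ciGL cover (compose nf π) π-U π-L
      in factorization pf π A.ψ-iso (compose nf π) A.class-preserved

  id∈AutUS : InAutUS G _~_ U L id
  id∈AutUS = (OnU.id-aut , λ _ _ _ _ → mk⇔ id id) , λ _ _ _ _ → mk⇔ id id

  id∈AutGLS : InAutGLS G _~_ U L id
  id∈AutGLS = (OnG/L.id-aut , λ _ _ _ _ → mk⇔ id id) , λ _ → mk⇔ id id

theorem1 : (G : FiniteGroup) → IsDirProdElemAb G
    → (_~_ : FiniteGroup.Carrier G → FiniteGroup.Carrier G → Bool)
    → IsSRing G (full G) (trivial G) _~_
    → (U L : Subset G)
    → IsASubgroup G _~_ U → IsASubgroup G _~_ L → _⊆_ G L U
    → IsNormalIn G L U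
    → IsWreath G _~_ U L
    → ¬ (∀ x → T (L x) → FiniteGroup._≈_ G x (FiniteGroup.ε G))
    → ¬ (∀ x → T (U x))
    → IsCI G U (trivial G) (quot G (trivial G) _~_)
    → IsCI G (full G) L (quot G L _~_)
    → (ProdCond G _~_ U L → IsCI G (full G) (trivial G) _~_)
    × (UCond G _~_ U L → IsCI G (full G) (trivial G) _~_)
    × (GLCond G _~_ U L → IsCI G (full G) (trivial G) _~_)
theorem1 G dp _~_ S U L AU AL L⊆U _ wreath _ _ ciU ciGL =
    (λ (cover , _) → prove cover)
  , (λ (cover , _) → prove λ σ σ∈ → let f , f∈ , σ≡ = cover σ σ∈ in f , id , f∈ , id∈AutGLS , σ≡)
  , (λ (cover , _) → prove λ σ σ∈ → let g , g∈ , σ≡ = cover σ σ∈ in id , g , id∈AutUS , g∈ , σ≡)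
  where
  open Wreath G dp _~_ S U L AU AL L⊆U
  prove = CI-of-cover wreath ciU ciGL
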